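{- Let $\Delta$ be of type $B_n$ and let $\mathfrak{Ab}$ be its poset of abelian ideals. Then (i) $\mathcal K^{u}_{\mathfrak{Ab}}(q)=\sum_{k\ge0}\binom{n+1}{2k}q^k$; (ii) $\mathcal K^{l}_{\mathfrak{Ab}}(q)=\sum_{k\ge0}\big(\binom{n-1}{2k+1}+\binom{n}{2k-1}+\binom{n-1}{2k-2}\big)q^k$; (iii) $D_{\mathfrak{Ab}}(q)=-\sum_{k\ge0}\binom{n-2}{2k+1}q^k$.
   Context: Type $B_n$: positive roots $\Delta^+=\{\varepsilon_i\pm\varepsilon_j\ (1\le i<j\le n),\ \varepsilon_i\ (1\le i\le n)\}$, simple roots $\varepsilon_i-\varepsilon_{i+1}$ ($i<n$), $\varepsilon_n$, with the root order (generated by $\gamma$ covering $\mu$ iff $\gamma-\mu$ is a simple root). An upper ideal $I\subset\Delta^+$ (up-closed subset) is abelian if $\gamma'+\gamma''\notin\Delta^+$ for all $\gamma',\gamma''\in I$; $\mathfrak{Ab}$ is the poset of all abelian upper ideals (including $\varnothing$) ordered by inclusion. For a finite poset $\mathcal P$, $\kappa(x)$ (resp. $\iota(x)$) is the number of elements covered by (resp. covering) $x$; $\mathcal K^{u}_{\mathcal P}=\sum_x q^{\kappa(x)}$, $\mathcal K^{l}_{\mathcal P}=\sum_x q^{\iota(x)}$, and $D_{\mathcal P}$ is defined by $\mathcal K^{u}_{\mathcal P}-\mathcal K^{l}_{\mathcal P}=(q-1)^2D_{\mathcal P}$. Binomial coefficients with negative lower index are $0$. -}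

module Defs where

open import Data.Bool using (Bool; true; false; _∧_; _∨_; not; if_then_else_)
open import Data.Nat using (ℕ; zero; suc; _+_; _*_; _∸_; _<ᵇ_; _≡ᵇ_)
open import Data.Nat.Combinatorics using (_C_)
open import Data.Integer as ℤ using (ℤ; +_; -[1+_])
open import Data.Fin using (Fin; toℕ)
open import Data.List as L using (List; []; _∷_; _++_; concatMap; allFin; filter; length)
open import Data.Bool.ListAction using (any; all)
open import Data.Vec as V using (Vec; []; _∷_; lookup; tabulate; zipWith)
open import Data.Vec.Properties using (≡-dec)
open import Data.Product using (_×_; _,_)
open import Relation.Nullary.Decidable using (⌊_⌋)

Wt : ℕ → Set
Wt n = Vec ℤ n

ε : ∀ {n} → Fin n → Wt n
ε i = tabulate λ j → if ⌊ i Data.Fin.≟ j ⌋ then + 1 else + 0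

_⊕_ : ∀ {n} → Wt n → Wt n → Wt n
_⊕_ = zipWith ℤ._+_

_⊖_ : ∀ {n} → Wt n → Wt n → Wt n
_⊖_ = zipWith ℤ._-_

_==_ : ∀ {n} → Wt n → Wt n → Bool
u == v = ⌊ ≡-dec ℤ._≟_ u v ⌋

_∈ᵇ_ : ∀ {n} → Wt n → List (Wt n) → Bool
v ∈ᵇ xs = any (v ==_) xs

pairs : ∀ n → List (Fin n × Fin n)
pairs n = concatMap (λ i → concatMap (λ j → if toℕ i <ᵇ toℕ j then (i , j) ∷ [] else []) (allFin n)) (allFin n)

posRootsL : ∀ n → List (Wt n)
posRootsL n = L.map (λ { (i , j) → ε i ⊖ ε j }) (pairs n)
           ++ L.map (λ { (i , j) → ε i ⊕ ε j }) (pairs n)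
           ++ L.map ε (allFin n)

simpleRoots : ∀ n → List (Wt n)
simpleRoots n = L.map (λ { (i , j) → ε i ⊖ ε j })
                  (filter (λ { (i , j) → suc (toℕ i) Data.Nat.≟ toℕ j }) (pairs n))
             ++ L.map ε (filter (λ i → suc (toℕ i) Data.Nat.≟ n) (allFin n))

N : ℕ → ℕ
N n = length (posRootsL n)

root : ∀ n → Fin (N n) → Wt n
root n = lookup (V.fromList (posRootsL n))

-- γ covers μ in the root order iff γ - μ is a simple root.
-- (The root order is the reflexive-transitive closure of this relation.)
covers : ∀ {n} → Wt n → Wt n → Bool
covers {n} γ μ = (γ ⊖ μ) ∈ᵇ simpleRoots n

Sub : ℕ → Set
Sub n = Vec Bool (N n)

allSubsets : ∀ m → List (Vec Bool m)
allSubsets zero = [] ∷ []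
allSubsets (suc m) = concatMap (λ v → (false ∷ v) ∷ (true ∷ v) ∷ []) (allSubsets m)

idx : ∀ n → List (Fin (N n))
idx n = allFin (N n)

-- I is an upper ideal: closed upward under the root order; equivalently,
-- closed under each covering step (the order is generated by covers).
isUpper : ∀ n → Sub n → Bool
isUpper n I = all (λ t → not (lookup I t) ∨
                  all (λ s → not (covers (root n s) (root n t)) ∨ lookup I s) (idx n)) (idx n)

isAbelian : ∀ n → Sub n → Bool
isAbelian n I = all (λ s → not (lookup I s) ∨
                  all (λ t → not (lookup I t) ∨ not ((root n s ⊕ root n t) ∈ᵇ posRootsL n)) (idx n)) (idx n)

filterᵇ : ∀ {A : Set} → (A → Bool) → List A → List A
filterᵇ p [] = []
filterᵇ p (x ∷ xs) = if p x then x ∷ filterᵇ p xs else filterᵇ p xs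

count : ∀ {A : Set} → (A → Bool) → List A → ℕ
count p xs = length (filterᵇ p xs)

-- the poset 𝔄𝔟 of all abelian upper ideals (incl. ∅), each listed exactly once
Ab : ∀ n → List (Sub n)
Ab n = filterᵇ (λ I → isUpper n I ∧ isAbelian n I) (allSubsets (N n))

_⊆ᵇ_ : ∀ {m} → Vec Bool m → Vec Bool m → Bool
[] ⊆ᵇ [] = true
(a ∷ u) ⊆ᵇ (b ∷ v) = (not a ∨ b) ∧ (u ⊆ᵇ v)

_⊂ᵇ_ : ∀ {m} → Vec Bool m → Vec Bool m → Bool
u ⊂ᵇ v = (u ⊆ᵇ v) ∧ not (v ⊆ᵇ u)

coversAb : ∀ n → Sub n → Sub n → Bool
coversAb n x y = (y ⊂ᵇ x) ∧ not (any (λ z → (y ⊂ᵇ z) ∧ (z ⊂ᵇ x)) (Ab n))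

κ : ∀ n → Sub n → ℕ
κ n x = count (λ y → coversAb n x y) (Ab n)

ι : ∀ n → Sub n → ℕ
ι n x = count (λ y → coversAb n y x) (Ab n)

-- coefficients of q^k in 𝒦ᵘ = Σₓ q^κ(x) and 𝒦ˡ = Σₓ q^ι(x)
Ku : ℕ → ℕ → ℕ
Ku n k = count (λ x → κ n x ≡ᵇ k) (Ab n)

Kl : ℕ → ℕ → ℕ
Kl n k = count (λ x → ι n x ≡ᵇ k) (Ab n)

binom : ℕ → ℤ → ℕ
binom n (+ k) = n C k
binom n -[1+ k ] = 0

-- coefficient of q^k in (q - 1)² · D, where D has coefficient sequence d
coeffSqMul : (ℕ → ℤ) → ℕ → ℤ
coeffSqMul d zero = d 0
coeffSqMul d (suc zero) = d 1 ℤ.- (+ 2) ℤ.* d 0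
coeffSqMul d (suc (suc k)) = d (suc (suc k)) ℤ.- (+ 2) ℤ.* d (suc k) ℤ.+ d k

-- Place the positive roots as boxes (i, c) of a shifted diagram, so that the root order becomes the
-- componentwise order. An upper ideal is then a strict partition, and it is abelian iff its two
-- longest rows a > m satisfy a + m ≤ 2n − 2 or m = 0. So an abelian ideal is a subset of
-- {1, …, n − 2} (the rows other than the first) together with a number a, and a covering relation
-- changes a single row by one box. For a fixed subset the admissible a form an interval on which κ
-- and ι are constant apart from the ends. Passing from n to n + 1 lengthens each interval by two and
-- adds the subsets containing n − 1, which turns both generating functions into Pascal recursions.
module Submission where

open import Defs
open import Data.Bool using (Bool; true; false; _∧_; _∨_; not; if_then_else_; T; T?)
open import Data.Bool.ListAction using (any; all)
open import Data.Bool.Properties using (T-∧)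
open import Data.Empty using (⊥; ⊥-elim)
open import Data.Unit using (tt)
open import Data.Fin using (Fin; toℕ; fromℕ<)
import Data.Fin.Properties as Fin
open import Data.Integer using (ℤ; +_) renaming (_+_ to _+ℤ_; _-_ to _-ℤ_; -_ to -ℤ_)
import Data.Integer as ℤ
import Data.Integer.Properties as ℤ
import Data.Integer.Tactic.RingSolver as ℤ-Solver
open import Data.List as List using (List; []; _∷_; _++_; map; concatMap; filter; length; upTo; allFin)
import Data.List.Properties as List
open import Data.List.Membership.Propositional using (_∈_; find; lose)
open import Data.List.Membership.Propositional.Properties
open import Data.List.Membership.Propositional.Properties.WithK using (unique∧set⇒bag)
open import Data.List.Relation.Binary.BagAndSetEquality using (∼bag⇒↭)
open import Data.List.Relation.Binary.Permutation.Propositional.Properties using (↭-length)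
open import Data.List.Relation.Unary.All as All using (All; []; _∷_)
import Data.List.Relation.Unary.All.Properties as All
open import Data.List.Relation.Unary.AllPairs using ([]; _∷_)
open import Data.List.Relation.Unary.Any as Any using (Any; here; there)
import Data.List.Relation.Unary.Any.Properties as Any
open import Data.List.Relation.Unary.Unique.Propositional using (Unique)
import Data.List.Relation.Unary.Unique.Propositional.Properties as Unique
open import Data.Nat
  using (ℕ; zero; suc; pred; _+_; _*_; _∸_; _≤_; _<_; _≤ᵇ_; _<ᵇ_; _≡ᵇ_; z≤n; s≤s; _≤?_; _<?_; _≟_)
open import Data.Nat.Combinatorics using (_C_; nCk+nC[k+1]≡[n+1]C[k+1])
open import Data.Nat.Properties
open import Data.Nat.Tactic.RingSolver using (solve-∀)
open import Data.Product using (∃-syntax; _×_; _,_; proj₁; proj₂)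
open import Data.Sum using (_⊎_; inj₁; inj₂; [_,_]′)
open import Data.Vec as Vec using (Vec; []; _∷_; lookup; tabulate)
import Data.Vec.Properties as Vec
open import Function using (_∘_; _⇔_; mk⇔; Equivalence)
open import Relation.Binary.Definitions using (tri<; tri≈; tri>)
open import Relation.Binary.PropositionalEquality
open import Relation.Nullary using (¬_; Dec; yes; no; does)
open import Relation.Nullary.Decidable using (toWitness; fromWitness; _×-dec_; _⊎-dec_; ⌊_⌋)

-- The even lower indices come from runs of bits. Write the rows below the first as a bit vector of
-- length `b = n − 2`. A part can go down (or vanish, if it is 1) exactly at the lower end of a
-- maximal run of ones; a part can go up, or a part 1 appear, exactly at the lower end of a maximal
-- run of zeros. A vector with `k` such runs is fixed by `2k` of its `b + 1` cut points, hence
-- `(b + 1) C 2k` in both cases. The bound on `a + m` has a single source: the boxes `(0, c)` and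
-- `(1, 2n − c)` are roots with sum ε₀ + ε₁. Once such pairs are excluded, no two members add up to
-- a root: their sum has an entry 2, three positive entries, or coordinate sum 4. Covering in the
-- poset is defined by the absence of an ideal in between, so single-box steps must be shown to
-- suffice. The lower rows are shrunk first, which cannot spoil the bound; the first row is
-- shortened only when the lower rows agree, and the smaller ideal then guarantees that its new
-- length is admissible.

-- Boolean reflection and counting in lists

to = Equivalence.to
from = Equivalence.from

T⇒≡ : ∀ {b} → T b → b ≡ true
T⇒≡ {true} _ = refl

≡⇒T : ∀ {b} → b ≡ true → T b
≡⇒T refl = tt

T-not : ∀ {b} → T (not b) ⇔ (¬ T b)
T-not {true}  = mk⇔ (λ ()) (λ f → f tt)
T-not {false} = mk⇔ (λ _ ()) (λ _ → tt)

T-⇒ : ∀ {a b} → T (not a ∨ b) ⇔ (T a → T b)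
T-⇒ {true}  = mk⇔ (λ h _ → h) (λ f → f tt)
T-⇒ {false} = mk⇔ (λ _ ()) (λ _ → tt)

T-cong : ∀ {a b} → T a ⇔ T b → a ≡ b
T-cong {true}  {true}  _ = refl
T-cong {true}  {false} e = ⊥-elim (to e tt)
T-cong {false} {true}  e = ⊥-elim (from e tt)
T-cong {false} {false} _ = refl

T-allFin : ∀ {n} (p : Fin n → Bool) → T (all p (allFin n)) ⇔ (∀ i → T (p i))
T-allFin p = mk⇔ (λ h i → All.lookup (All.all⁺ p _ h) (∈-allFin i))
                 (λ h → All.all⁻ p (All.tabulate {xs = allFin _} (λ {i} _ → h i)))

module _ {A : Set} where

  T-any : ∀ (p : A → Bool) xs → T (any p xs) ⇔ (∃[ x ] x ∈ xs × T (p x))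
  T-any p xs = mk⇔ (λ h → find (Any.any⁻ p xs h)) (λ (_ , x∈ , px) → Any.any⁺ p (lose x∈ px))

  filterᵇ≡filter : ∀ (p : A → Bool) xs → filterᵇ p xs ≡ filter (T? ∘ p) xs
  filterᵇ≡filter p [] = refl
  filterᵇ≡filter p (x ∷ xs) with p x
  ... | true  = cong (x ∷_) (filterᵇ≡filter p xs)
  ... | false = filterᵇ≡filter p xs

  ∈-filterᵇ : ∀ (p : A → Bool) {x} xs → x ∈ filterᵇ p xs ⇔ (x ∈ xs × T (p x))
  ∈-filterᵇ p xs rewrite filterᵇ≡filter p xs =
    mk⇔ (∈-filter⁻ (T? ∘ p)) (λ (x∈ , px) → ∈-filter⁺ (T? ∘ p) x∈ px)

  unique-filterᵇ : ∀ (p : A → Bool) {xs} → Unique xs → Unique (filterᵇ p xs)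
  unique-filterᵇ p {xs} u rewrite filterᵇ≡filter p xs = Unique.filter⁺ (T? ∘ p) u

  length-unique : ∀ {xs ys : List A} → Unique xs → Unique ys →
                  (∀ {z} → z ∈ xs ⇔ z ∈ ys) → length xs ≡ length ys
  length-unique u v e = ↭-length (∼bag⇒↭ (unique∧set⇒bag u v e))

  count-++ : ∀ (p : A → Bool) xs ys → count p (xs ++ ys) ≡ count p xs + count p ys
  count-++ p [] ys = refl
  count-++ p (x ∷ xs) ys with p x
  ... | true  = cong suc (count-++ p xs ys)
  ... | false = count-++ p xs ys

  count-cong : ∀ {p q : A → Bool} xs → (∀ {x} → x ∈ xs → p x ≡ q x) → count p xs ≡ count q xs
  count-cong [] h = refl
  count-cong {p} {q} (x ∷ xs) h with p x | q x | h (here refl)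
  ... | true  | true  | refl = cong suc (count-cong xs (h ∘ there))
  ... | false | false | refl = count-cong xs (h ∘ there)

  ∈-concatMap : ∀ {B : Set} {f : A → List B} {xs y} →
                y ∈ concatMap f xs ⇔ (∃[ x ] x ∈ xs × y ∈ f x)
  ∈-concatMap {f = f} = mk⇔ (find ∘ ∈-concatMap⁻ f) (λ (_ , x∈ , y∈) → ∈-concatMap⁺ f (lose x∈ y∈))

  unique-map : ∀ {B : Set} {f : A → B} {xs} →
               (∀ {x x′} → x ∈ xs → x′ ∈ xs → f x ≡ f x′ → x ≡ x′) → Unique xs → Unique (map f xs)
  unique-map inj [] = []
  unique-map {f = f} {x ∷ xs} inj (x∉ ∷ u) =
    All.map⁺ (All.tabulate λ x′∈ e → All.lookup x∉ x′∈ (inj (here refl) (there x′∈) e))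
    ∷ unique-map (λ x∈ x′∈ → inj (there x∈) (there x′∈)) u

  -- The map `g` recovers from an element the block that contains it, so different blocks are
  -- disjoint.
  unique-concatMap : ∀ {B : Set} {f : A → List B} (g : B → A) {xs} → Unique xs →
                     (∀ x → Unique (f x)) → (∀ x {y} → y ∈ f x → g y ≡ x) → Unique (concatMap f xs)
  unique-concatMap g [] _ _ = []
  unique-concatMap {f = f} g {x ∷ xs} (x∉ ∷ u) uf gf =
    Unique.++⁺ (uf x) (unique-concatMap g u uf gf) λ (y∈ , y∈′) →
      let (x′ , x′∈ , y∈f) = to ∈-concatMap y∈′ in
      All.lookup x∉ x′∈ (trans (sym (gf x y∈)) (gf x′ y∈f))

count-map : ∀ {A B : Set} (p : B → Bool) (f : A → B) xs → count p (map f xs) ≡ count (p ∘ f) xs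
count-map p f [] = refl
count-map p f (x ∷ xs) with p (f x)
... | true  = cong suc (count-map p f xs)
... | false = count-map p f xs

-- Injectivity is asked on `xs` only: the encoding of codes identifies first rows that are too long
-- for the diagram.
count-transport : ∀ {A B : Set} {f : A → B} {xs : List A} {ys : List B} →
                  (∀ {x x′} → x ∈ xs → x′ ∈ xs → f x ≡ f x′ → x ≡ x′) → Unique xs → Unique ys →
                  (∀ {y} → y ∈ ys ⇔ (∃[ x ] x ∈ xs × y ≡ f x)) →
                  ∀ p → count p ys ≡ count (p ∘ f) xs
count-transport {f = f} {xs} {ys} inj u v e p =
  trans (length-unique (unique-filterᵇ p v) (unique-map inj′ (unique-filterᵇ (p ∘ f) u)) same)
        (List.length-map f (filterᵇ (p ∘ f) xs))
  where
  inj′ : ∀ {x x′} → x ∈ filterᵇ (p ∘ f) xs → x′ ∈ filterᵇ (p ∘ f) xs → f x ≡ f x′ → x ≡ x′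
  inj′ x∈ x′∈ = inj (proj₁ (to (∈-filterᵇ (p ∘ f) xs) x∈)) (proj₁ (to (∈-filterᵇ (p ∘ f) xs) x′∈))

  same : ∀ {y} → y ∈ filterᵇ p ys ⇔ y ∈ map f (filterᵇ (p ∘ f) xs)
  same = mk⇔
    (λ h → let (y∈ , py) = to (∈-filterᵇ p ys) h ; (x , x∈ , y≡) = to e y∈ in
           subst (_∈ _) (sym y≡) (∈-map⁺ f (from (∈-filterᵇ (p ∘ f) xs) (x∈ , subst (T ∘ p) y≡ py))))
    (λ h → let (x , x∈f , y≡) = ∈-map⁻ f h ; (x∈ , px) = to (∈-filterᵇ (p ∘ f) xs) x∈f in
           from (∈-filterᵇ p ys) (from e (x , x∈ , y≡) , subst (T ∘ p) (sym y≡) px))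

-- Roots as boxes of a shifted diagram

χ : ℕ → ℕ → ℤ
χ m k = if m ≡ᵇ k then + 1 else + 0

e : ∀ {n} → ℕ → Wt n
e m = tabulate (χ m ∘ toℕ)

at : ∀ {n} → Wt n → ℕ → ℤ
at []      k       = + 0
at (x ∷ w) zero    = x
at (x ∷ w) (suc k) = at w k

-- The coefficient of the k-th simple root.
psum : ∀ {n} → Wt n → ℕ → ℤ
psum []      k       = + 0
psum (x ∷ w) zero    = x
psum (x ∷ w) (suc k) = x +ℤ psum w k

step : ℕ → ℕ → ℤ
step m k = if m ≤ᵇ k then + 1 else + 0

χ-same : ∀ k → χ k k ≡ + 1
χ-same k with k ≡ᵇ k in eq
... | true  = refl
... | false = ⊥-elim (subst T eq (≡⇒≡ᵇ k k refl))

χ-diff : ∀ {m k} → ¬ m ≡ k → χ m k ≡ + 0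
χ-diff {m} {k} m≢k with m ≡ᵇ k in eq
... | true  = ⊥-elim (m≢k (≡ᵇ⇒≡ m k (≡⇒T eq)))
... | false = refl

χ-outside : ∀ {n m k} → k < n → n ≤ m → χ m k ≡ + 0
χ-outside k<n n≤m = χ-diff (>⇒≢ (<-≤-trans k<n n≤m))

step-1 : ∀ {m k} → m ≤ k → step m k ≡ + 1
step-1 {m} {k} m≤k rewrite T⇒≡ (≤⇒≤ᵇ m≤k) = refl

step-0 : ∀ {m k} → k < m → step m k ≡ + 0
step-0 {m} {k} k<m with m ≤ᵇ k in eq
... | true  = ⊥-elim (<-irrefl refl (≤-trans k<m (≤ᵇ⇒≤ m k (≡⇒T eq))))
... | false = refl

step-suc : ∀ m k → step (suc m) (suc k) ≡ step m k
step-suc zero    k = refl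
step-suc (suc m) k = refl

at-⊕ : ∀ {n} (u v : Wt n) k → at (u ⊕ v) k ≡ at u k +ℤ at v k
at-⊕ []      []      k       = refl
at-⊕ (x ∷ u) (y ∷ v) zero    = refl
at-⊕ (x ∷ u) (y ∷ v) (suc k) = at-⊕ u v k

at-⊖ : ∀ {n} (u v : Wt n) k → at (u ⊖ v) k ≡ at u k -ℤ at v k
at-⊖ []      []      k       = refl
at-⊖ (x ∷ u) (y ∷ v) zero    = refl
at-⊖ (x ∷ u) (y ∷ v) (suc k) = at-⊖ u v k

at-e : ∀ {n} m {k} → k < n → at (e {n} m) k ≡ χ m k
at-e m {k} k<n = go (χ m) k<n
  where
  go : ∀ {n} (f : ℕ → ℤ) {k} → k < n → at (tabulate {n = n} (f ∘ toℕ)) k ≡ f k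
  go f {zero}  (s≤s _)   = refl
  go f {suc k} (s≤s k<n) = go (f ∘ suc) k<n

at-ext : ∀ {n} {u v : Wt n} → (∀ {k} → k < n → at u k ≡ at v k) → u ≡ v
at-ext {u = []}    {[]}    h = refl
at-ext {u = x ∷ u} {y ∷ v} h = cong₂ _∷_ (h (s≤s z≤n)) (at-ext (h ∘ s≤s))

psum-⊕ : ∀ {n} (u v : Wt n) k → psum (u ⊕ v) k ≡ psum u k +ℤ psum v k
psum-⊕ []      []      k       = refl
psum-⊕ (x ∷ u) (y ∷ v) zero    = refl
psum-⊕ (x ∷ u) (y ∷ v) (suc k) rewrite psum-⊕ u v k = shuffle x y (psum u k) (psum v k)
  where
  shuffle : ∀ a b c d → (a +ℤ b) +ℤ (c +ℤ d) ≡ (a +ℤ c) +ℤ (b +ℤ d)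
  shuffle = ℤ-Solver.solve-∀

psum-⊖ : ∀ {n} (u v : Wt n) k → psum (u ⊖ v) k ≡ psum u k -ℤ psum v k
psum-⊖ []      []      k       = refl
psum-⊖ (x ∷ u) (y ∷ v) zero    = refl
psum-⊖ (x ∷ u) (y ∷ v) (suc k) rewrite psum-⊖ u v k = shuffle x y (psum u k) (psum v k)
  where
  shuffle : ∀ a b c d → (a -ℤ b) +ℤ (c -ℤ d) ≡ (a +ℤ c) -ℤ (b +ℤ d)
  shuffle = ℤ-Solver.solve-∀

psum-e : ∀ {n} m {k} → k < n → psum (e {n} m) k ≡ step m k
psum-e {suc n} zero    {zero}  _         = refl
psum-e {suc n} (suc m) {zero}  _         = refl
psum-e {suc n} zero    {suc k} (s≤s k<n) = cong ((+ 1) +ℤ_) (zeros n k)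
  where
  zeros : ∀ n k → psum (tabulate {n = n} (λ _ → + 0)) k ≡ + 0
  zeros zero    k       = refl
  zeros (suc n) zero    = refl
  zeros (suc n) (suc k) = trans (ℤ.+-identityˡ _) (zeros n k)
psum-e {suc n} (suc m) {suc k} (s≤s k<n) =
  trans (ℤ.+-identityˡ _) (trans (psum-e m k<n) (sym (step-suc m k)))

ε≡e : ∀ {n} (i : Fin n) → ε i ≡ e (toℕ i)
ε≡e i = Vec.tabulate-cong λ j → agree j
  where
  agree : ∀ j → (if ⌊ i Fin.≟ j ⌋ then + 1 else + 0) ≡ χ (toℕ i) (toℕ j)
  agree j with i Fin.≟ j
  ... | yes refl = sym (χ-same (toℕ i))
  ... | no  i≢j  = sym (χ-diff (i≢j ∘ Fin.toℕ-injective))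

-- The box (i, c), with c + c′ ≡ 2n, stands for the root e i + e c − e c′. As e k = 0 for k ≥ n, this
-- is εᵢ + ε_c for c < n, εᵢ for c = n, and εᵢ − ε_c′ for c > n (indices start at 0).
record Box (n : ℕ) : Set where
  constructor box
  field
    i c c′ : ℕ
    i<c    : i < c
    i<c′   : i < c′
    c+c′   : c + c′ ≡ n + n

  i<n : i < n
  i<n with i <? n
  ... | yes p = p
  ... | no  q = ⊥-elim (<-irrefl (sym c+c′) (+-mono-< (≤-<-trans (≮⇒≥ q) i<c) (≤-<-trans (≮⇒≥ q) i<c′)))

  inRange : c < n → n < c′
  inRange c<n with n <? c′
  ... | yes p = p
  ... | no  q = ⊥-elim (<-irrefl c+c′ (+-mono-<-≤ c<n (≮⇒≥ q)))

  outOfRange : n ≤ c → c′ ≤ n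
  outOfRange n≤c with c′ ≤? n
  ... | yes p = p
  ... | no  q = ⊥-elim (<-irrefl (sym c+c′) (+-mono-≤-< n≤c (≰⇒> q)))

module _ {n : ℕ} (β : Box n) where
  open Box β

  opaque
    weight : Wt n
    weight = (e i ⊕ e c) ⊖ e c′

    at-weight : ∀ {k} → k < n → at weight k ≡ (χ i k +ℤ χ c k) -ℤ χ c′ k
    at-weight {k} k<n
      rewrite at-⊖ (e {n} i ⊕ e c) (e c′) k | at-⊕ (e {n} i) (e c) k
            | at-e i k<n | at-e c k<n | at-e c′ k<n = refl

    psum-weight : ∀ {k} → k < n → psum weight k ≡ (step i k +ℤ step c k) -ℤ step c′ k
    psum-weight {k} k<n
      rewrite psum-⊖ (e {n} i ⊕ e c) (e c′) k | psum-⊕ (e {n} i) (e c) k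
            | psum-e {n} i k<n | psum-e {n} c k<n | psum-e {n} c′ k<n = refl

  ≡weight : ∀ {w} → (∀ {k} → k < n → at w k ≡ (χ i k +ℤ χ c k) -ℤ χ c′ k) → w ≡ weight
  ≡weight h = at-ext λ k<n → trans (h k<n) (sym (at-weight k<n))

weight-cong : ∀ {n} (β γ : Box n) → Box.i β ≡ Box.i γ → Box.c β ≡ Box.c γ → weight β ≡ weight γ
weight-cong β@(box i c c′ _ _ eq) γ@(box .i .c d′ _ _ eq′) refl refl
  with +-cancelˡ-≡ c c′ d′ (trans eq (sym eq′))
... | refl = ≡weight γ (at-weight β)

-- Prefix sums are coordinates in the simple roots, and one prefix decides each inequality: `k = i`,
-- where the sum for `μ` is already 1; `k = c` if `c < n`, where it is 2; and otherwise
-- `k = c′ − 1`, the last place before `e c′` is subtracted.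
weight-reflects-order : ∀ {n} (μ γ : Box n) →
  (∀ {k} → k < n → psum (weight μ) k ℤ.≤ psum (weight γ) k) → Box.i γ ≤ Box.i μ × Box.c γ ≤ Box.c μ
weight-reflects-order {n} μ@(box i c c′ i<c i<c′ c+c′) γ@(box j d d′ j<d j<d′ d+d′) h = j≤i , d≤c
  where
  h′ : ∀ {k} → k < n → (step i k +ℤ step c k) -ℤ step c′ k ℤ.≤ (step j k +ℤ step d k) -ℤ step d′ k
  h′ k<n = subst₂ ℤ._≤_ (psum-weight μ k<n) (psum-weight γ k<n) (h k<n)

  j≤i : j ≤ i
  j≤i with j ≤? i
  ... | yes p = p
  ... | no  q with h′ (Box.i<n μ)
  ... | r rewrite step-1 {i} ≤-refl | step-0 i<c | step-0 i<c′ | step-0 (≰⇒> q)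
                | step-0 (<-trans (≰⇒> q) j<d) | step-0 (<-trans (≰⇒> q) j<d′) with r
  ... | ℤ.+≤+ ()

  d≤c : d ≤ c
  d≤c with d ≤? c
  ... | yes p = p
  ... | no  q with c <? n
  ...   | yes c<n with h′ c<n
  ...     | r rewrite step-1 (<⇒≤ i<c) | step-1 {c} ≤-refl | step-0 (<-trans c<n (Box.inRange μ c<n))
                    | step-0 (≰⇒> q) with j ≤ᵇ c | d′ ≤ᵇ c | r
  ...       | true  | true  | ℤ.+≤+ ()
  ...       | true  | false | ℤ.+≤+ (s≤s ())
  ...       | false | true  | ()
  ...       | false | false | ℤ.+≤+ ()
  d≤c | no q | no c≮n = last c′ i<c′ (Box.outOfRange μ (≮⇒≥ c≮n)) d′<c′ h′
    where
    d′<c′ : d′ < c′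
    d′<c′ with d′ <? c′
    ... | yes p = p
    ... | no  p = ⊥-elim (<-irrefl (trans c+c′ (sym d+d′)) (+-mono-<-≤ (≰⇒> q) (≮⇒≥ p)))

    last : ∀ c′ → i < c′ → c′ ≤ n → d′ < c′ →
           (∀ {k} → k < n → (step i k +ℤ step c k) -ℤ step c′ k ℤ.≤ (step j k +ℤ step d k) -ℤ step d′ k) → d ≤ c
    last (suc k) (s≤s i≤k) k<n (s≤s d′≤k) g with g k<n
    ... | r rewrite step-1 i≤k | step-0 {suc k} {k} ≤-refl | step-1 d′≤k
                  | step-0 (≤-trans k<n (≮⇒≥ c≮n)) | step-0 (<-trans (≤-trans k<n (≮⇒≥ c≮n)) (≰⇒> q))
            with j ≤ᵇ k | r
    ... | true  | ℤ.+≤+ ()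
    ... | false | ()

-- The list of positive roots

module _ {n : ℕ} where

  pairIf : Fin n → Fin n → List (Fin n × Fin n)
  pairIf i j = if toℕ i <ᵇ toℕ j then (i , j) ∷ [] else []

  ∈-pairIf : ∀ i j {p} → p ∈ pairIf i j → toℕ i < toℕ j × p ≡ (i , j)
  ∈-pairIf i j p∈ with toℕ i <ᵇ toℕ j in eq | p∈
  ... | true | here refl = <ᵇ⇒< _ _ (≡⇒T eq) , refl

  pairsFrom : Fin n → List (Fin n × Fin n)
  pairsFrom i = concatMap (pairIf i) (allFin n)

  ∈-pairs : ∀ {i j} → (i , j) ∈ pairs n ⇔ toℕ i < toℕ j
  ∈-pairs {i} {j} = mk⇔ ⇒ ⇐
    where
    ⇒ : (i , j) ∈ pairs n → toℕ i < toℕ j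
    ⇒ h with to (∈-concatMap {f = pairsFrom} {allFin n}) h
    ... | i′ , _ , h₁ with to (∈-concatMap {f = pairIf i′} {allFin n}) h₁
    ... | j′ , _ , h₂ with ∈-pairIf i′ j′ h₂
    ... | i<j , refl = i<j

    ⇐ : toℕ i < toℕ j → (i , j) ∈ pairs n
    ⇐ i<j = from (∈-concatMap {f = pairsFrom} {allFin n})
              (i , ∈-allFin i , from (∈-concatMap {f = pairIf i} {allFin n}) (j , ∈-allFin j , mem))
      where
      mem : (i , j) ∈ pairIf i j
      mem rewrite T⇒≡ (<⇒<ᵇ i<j) = here refl

  unique-pairs : Unique (pairs n)
  unique-pairs = unique-concatMap proj₁ (Unique.allFin⁺ n)
    (λ i → unique-concatMap proj₂ (Unique.allFin⁺ n) (uniqueIf i) (λ j → cong proj₂ ∘ proj₂ ∘ ∈-pairIf i j))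
    (λ i p∈ → let (j , _ , p∈′) = to (∈-concatMap {f = pairIf i} {allFin n}) p∈ in cong proj₁ (proj₂ (∈-pairIf i j p∈′)))
    where
    uniqueIf : ∀ i j → Unique (pairIf i j)
    uniqueIf i j with toℕ i <ᵇ toℕ j
    ... | true  = [] ∷ []
    ... | false = []

toℕ≤n+n : ∀ {n} (j : Fin n) → toℕ j ≤ n + n
toℕ≤n+n j = ≤-trans (<⇒≤ (Fin.toℕ<n j)) (m≤m+n _ _)

n≤n+n∸ : ∀ {n j} → j ≤ n → n ≤ n + n ∸ j
n≤n+n∸ {n} {j} j≤n = subst (_≤ n + n ∸ j) (m+n∸m≡n j n) (∸-monoˡ-≤ j (+-monoˡ-≤ n j≤n))

plusBox minusBox : ∀ {n} {i j : Fin n} → toℕ i < toℕ j → Box n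
plusBox {n} {i} {j} i<j = box (toℕ i) (toℕ j) (n + n ∸ toℕ j) i<j
  (<-≤-trans (Fin.toℕ<n i) (n≤n+n∸ (<⇒≤ (Fin.toℕ<n j)))) (m+[n∸m]≡n (toℕ≤n+n j))
minusBox {n} {i} {j} i<j = box (toℕ i) (n + n ∸ toℕ j) (toℕ j)
  (<-≤-trans (Fin.toℕ<n i) (n≤n+n∸ (<⇒≤ (Fin.toℕ<n j)))) i<j (m∸n+n≡m (toℕ≤n+n j))

shortBox : ∀ {n} → Fin n → Box n
shortBox {n} i = box (toℕ i) n n (Fin.toℕ<n i) (Fin.toℕ<n i) refl

weight-plus : ∀ {n} {i j : Fin n} (i<j : toℕ i < toℕ j) → ε i ⊕ ε j ≡ weight (plusBox i<j)
weight-plus {n} {i} {j} i<j rewrite ε≡e i | ε≡e j = ≡weight (plusBox {i = i} {j} i<j) λ {k} k<n →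
  trans (trans (at-⊕ (e {n} (toℕ i)) (e (toℕ j)) k) (cong₂ _+ℤ_ (at-e (toℕ i) k<n) (at-e (toℕ j) k<n)))
    (sym (trans (cong (λ z → (χ (toℕ i) k +ℤ χ (toℕ j) k) -ℤ z)
                      (χ-outside k<n (n≤n+n∸ (<⇒≤ (Fin.toℕ<n j)))))
                (ℤ.+-identityʳ _)))

weight-minus : ∀ {n} {i j : Fin n} (i<j : toℕ i < toℕ j) → ε i ⊖ ε j ≡ weight (minusBox i<j)
weight-minus {n} {i} {j} i<j rewrite ε≡e i | ε≡e j = ≡weight (minusBox {i = i} {j} i<j) λ {k} k<n →
  trans (trans (at-⊖ (e {n} (toℕ i)) (e (toℕ j)) k) (cong₂ _-ℤ_ (at-e (toℕ i) k<n) (at-e (toℕ j) k<n)))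
    (cong (_-ℤ χ (toℕ j) k)
      (sym (trans (cong (χ (toℕ i) k +ℤ_) (χ-outside k<n (n≤n+n∸ (<⇒≤ (Fin.toℕ<n j)))))
                  (ℤ.+-identityʳ (χ (toℕ i) k)))))

weight-short : ∀ {n} (i : Fin n) → ε i ≡ weight (shortBox i)
weight-short {n} i rewrite ε≡e i = ≡weight (shortBox i) λ {k} k<n →
  trans (at-e (toℕ i) k<n) (sym (cancel (χ (toℕ i) k) (χ n k)))
  where
  cancel : ∀ a b → (a +ℤ b) -ℤ b ≡ a
  cancel = ℤ-Solver.solve-∀

∈-posRoots : ∀ {n} {w : Wt n} → w ∈ posRootsL n ⇔ (∃[ β ] w ≡ weight {n} β)
∈-posRoots {n} {w} = mk⇔ ⇒ (λ (β , w≡) → subst (_∈ posRootsL n) (sym w≡) (⇐ β))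
  where
  minus plus : Fin n × Fin n → Wt n
  minus (i , j) = ε i ⊖ ε j
  plus  (i , j) = ε i ⊕ ε j

  ⇒ : w ∈ posRootsL n → ∃[ β ] w ≡ weight {n} β
  ⇒ h with ∈-++⁻ (map minus (pairs n)) h
  ... | inj₁ h₁ with ∈-map⁻ minus h₁
  ...   | (i , j) , ij∈ , w≡ = minusBox (to ∈-pairs ij∈) , trans w≡ (weight-minus (to ∈-pairs ij∈))
  ⇒ h | inj₂ h₁ with ∈-++⁻ (map plus (pairs n)) h₁
  ... | inj₁ h₂ with ∈-map⁻ plus h₂
  ...   | (i , j) , ij∈ , w≡ = plusBox (to ∈-pairs ij∈) , trans w≡ (weight-plus (to ∈-pairs ij∈))
  ⇒ h | inj₂ h₁ | inj₂ h₂ with ∈-map⁻ ε h₂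
  ... | i , _ , w≡ = shortBox i , trans w≡ (weight-short i)

  fin : ∀ {k} → k < n → ∃[ i ] toℕ {n} i ≡ k
  fin k<n = fromℕ< k<n , Fin.toℕ-fromℕ< k<n

  outOfRange< : ∀ {c c′} → n < c → c + c′ ≡ n + n → c′ < n
  outOfRange< {c} {c′} n<c eq with c′ <? n
  ... | yes p = p
  ... | no  q = ⊥-elim (<-irrefl (sym eq) (+-mono-<-≤ n<c (≮⇒≥ q)))

  complement : ∀ {c c′} → c + c′ ≡ n + n → n + n ∸ c′ ≡ c
  complement {c} {c′} eq = trans (cong (_∸ c′) (sym eq)) (m+n∸n≡m c c′)

  ⇐ : ∀ β → weight β ∈ posRootsL n
  ⇐ β@(box i c c′ i<c i<c′ c+c′) with <-cmp c n | fin (Box.i<n β)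
  ... | tri< c<n _ _ | i′ , refl with fin c<n
  ...   | c″ , refl = ∈-++⁺ʳ (map minus (pairs n)) (∈-++⁺ˡ
          (subst (_∈ _) (trans (weight-plus i<c) (weight-cong (plusBox i<c) β refl refl))
            (∈-map⁺ plus (from ∈-pairs i<c))))
  ⇐ β@(box _ .n c′ i<c i<c′ c+c′) | tri≈ _ refl _ | i′ , refl =
        ∈-++⁺ʳ (map minus (pairs n)) (∈-++⁺ʳ (map plus (pairs n))
          (subst (_∈ _) (trans (weight-short i′) (weight-cong (shortBox i′) β refl refl))
            (∈-map⁺ ε (∈-allFin i′))))
  ⇐ β@(box _ c c′ i<c i<c′ c+c′) | tri> _ _ n<c | i′ , refl with fin (outOfRange< n<c c+c′)
  ... | c″ , refl = ∈-++⁺ˡ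
          (subst (_∈ _) (trans (weight-minus i<c′) (weight-cong (minusBox i<c′) β refl (complement {c} c+c′)))
            (∈-map⁺ minus (from ∈-pairs i<c′)))

-- Equal weights dominate each other, so the box order can be used in both directions and
-- antisymmetry finishes.
weight-injective : ∀ {n} (β γ : Box n) → weight β ≡ weight γ →
                   Box.i β ≡ Box.i γ × Box.c β ≡ Box.c γ × Box.c′ β ≡ Box.c′ γ
weight-injective β γ eq with
  weight-reflects-order β γ (λ {k} _ → ℤ.≤-reflexive (cong (λ w → psum w k) eq)) |
  weight-reflects-order γ β (λ {k} _ → ℤ.≤-reflexive (cong (λ w → psum w k) (sym eq)))
... | i≥ , c≥ | i≤ , c≤ with ≤-antisym i≤ i≥ | ≤-antisym c≤ c≥
... | refl | refl = refl , refl , +-cancelˡ-≡ (Box.c β) _ _ (trans (Box.c+c′ β) (sym (Box.c+c′ γ)))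

-- An ideal is a set of list positions, and this identifies positions with roots. The three families
-- are told apart by where `c` or `c′` lies relative to `n`.
unique-posRoots : ∀ n → Unique (posRootsL n)
unique-posRoots n =
  Unique.++⁺ (unique-map minus-inj unique-pairs)
    (Unique.++⁺ (unique-map plus-inj unique-pairs) (unique-map (λ _ _ → short-inj) (Unique.allFin⁺ n)) plus≠short)
    minus≠rest
  where
  minus plus : Fin n × Fin n → Wt n
  minus (i , j) = ε i ⊖ ε j
  plus  (i , j) = ε i ⊕ ε j

  box≡ : ∀ {u v} (β γ : Box n) → u ≡ weight β → v ≡ weight γ → u ≡ v →
         Box.i β ≡ Box.i γ × Box.c β ≡ Box.c γ × Box.c′ β ≡ Box.c′ γ
  box≡ β γ u≡ v≡ u≡v = weight-injective β γ (trans (sym u≡) (trans u≡v v≡))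

  minus-inj : ∀ {p q} → p ∈ pairs n → q ∈ pairs n → minus p ≡ minus q → p ≡ q
  minus-inj p∈ q∈ eq =
    let (i≡ , _ , j≡) = box≡ (minusBox (to ∈-pairs p∈)) (minusBox (to ∈-pairs q∈)) (weight-minus _) (weight-minus _) eq
    in cong₂ _,_ (Fin.toℕ-injective i≡) (Fin.toℕ-injective j≡)

  plus-inj : ∀ {p q} → p ∈ pairs n → q ∈ pairs n → plus p ≡ plus q → p ≡ q
  plus-inj p∈ q∈ eq =
    let (i≡ , j≡ , _) = box≡ (plusBox (to ∈-pairs p∈)) (plusBox (to ∈-pairs q∈)) (weight-plus _) (weight-plus _) eq
    in cong₂ _,_ (Fin.toℕ-injective i≡) (Fin.toℕ-injective j≡)

  short-inj : ∀ {i j : Fin n} → ε i ≡ ε j → i ≡ j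
  short-inj {i} {j} eq =
    Fin.toℕ-injective (proj₁ (box≡ (shortBox i) (shortBox j) (weight-short i) (weight-short j) eq))

  plus≠short : ∀ {w} → ¬ (w ∈ map plus (pairs n) × w ∈ map ε (allFin n))
  plus≠short (w∈ , w∈′) =
    let ((i , j) , p∈ , w≡) = ∈-map⁻ plus w∈ ; (k , _ , w≡′) = ∈-map⁻ ε w∈′
        (_ , j≡n , _) = box≡ (plusBox (to ∈-pairs p∈)) (shortBox k) (weight-plus _) (weight-short k) (trans (sym w≡) w≡′)
    in <⇒≢ (Fin.toℕ<n j) j≡n

  minus≠plus : ∀ {w} → w ∈ map minus (pairs n) → ¬ w ∈ map plus (pairs n)
  minus≠plus w∈ w∈′ =
    let ((i , j) , p∈ , w≡) = ∈-map⁻ minus w∈ ; ((k , l) , q∈ , w≡′) = ∈-map⁻ plus w∈′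
        (_ , _ , j≡) = box≡ (minusBox (to ∈-pairs p∈)) (plusBox (to ∈-pairs q∈)) (weight-minus _) (weight-plus _)
                            (trans (sym w≡) w≡′)
    in <⇒≢ (<-≤-trans (Fin.toℕ<n j) (n≤n+n∸ (<⇒≤ (Fin.toℕ<n l)))) j≡

  minus≠short : ∀ {w} → w ∈ map minus (pairs n) → ¬ w ∈ map ε (allFin n)
  minus≠short w∈ w∈′ =
    let ((i , j) , p∈ , w≡) = ∈-map⁻ minus w∈ ; (k , _ , w≡′) = ∈-map⁻ ε w∈′
        (_ , _ , j≡n) = box≡ (minusBox (to ∈-pairs p∈)) (shortBox k) (weight-minus _) (weight-short k)
                             (trans (sym w≡) w≡′)
    in <⇒≢ (Fin.toℕ<n j) j≡n

  minus≠rest : ∀ {w} → ¬ (w ∈ map minus (pairs n) × w ∈ (map plus (pairs n) ++ map ε (allFin n)))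
  minus≠rest (w∈ , w∈′) = [ minus≠plus w∈ , minus≠short w∈ ]′ (∈-++⁻ (map plus (pairs n)) w∈′)

-- Simple roots and covering relations

-- For `s = n − 1` the second term vanishes, so the short simple root is covered by the same formula
-- as the long ones.
α : ∀ {n} → ℕ → Wt n
α s = e s ⊖ e (suc s)

α-last : ∀ {n} {i : Fin n} → suc (toℕ i) ≡ n → ε i ≡ α (toℕ i)
α-last {n} {i} eq rewrite ε≡e i = at-ext λ {k} k<n →
  trans (at-e (toℕ i) k<n) (sym (trans (at-⊖ (e {n} (toℕ i)) (e (suc (toℕ i))) k)
    (trans (cong₂ _-ℤ_ (at-e (toℕ i) k<n)
              (trans (at-e (suc (toℕ i)) k<n) (χ-outside k<n (≤-reflexive (sym eq)))))
           (ℤ.+-identityʳ (χ (toℕ i) k)))))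

∈-simpleRoots : ∀ {n} {w : Wt n} → w ∈ simpleRoots n ⇔ (∃[ s ] s < n × w ≡ α s)
∈-simpleRoots {n} {w} = mk⇔ ⇒ ⇐
  where
  minus : Fin n × Fin n → Wt n
  minus (i , j) = ε i ⊖ ε j

  adjacent? : (p : Fin n × Fin n) → Dec (suc (toℕ (proj₁ p)) ≡ toℕ (proj₂ p))
  adjacent? (i , j) = suc (toℕ i) ≟ toℕ j

  last? : (i : Fin n) → Dec (suc (toℕ i) ≡ n)
  last? i = suc (toℕ i) ≟ n

  minus≡α : ∀ i j → suc (toℕ i) ≡ toℕ j → minus (i , j) ≡ α (toℕ i)
  minus≡α i j eq rewrite ε≡e i | ε≡e j | eq = refl

  ⇒ : w ∈ simpleRoots n → ∃[ s ] s < n × w ≡ α s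
  ⇒ h with ∈-++⁻ (map minus (filter adjacent? (pairs n))) h
  ... | inj₁ h₁ with ∈-map⁻ minus h₁
  ...   | (i , j) , p∈ , w≡ =
          toℕ i , Fin.toℕ<n i , trans w≡ (minus≡α i j (proj₂ (∈-filter⁻ adjacent? {xs = pairs n} p∈)))
  ⇒ h | inj₂ h₁ with ∈-map⁻ ε h₁
  ... | i , i∈ , w≡ = toℕ i , Fin.toℕ<n i , trans w≡ (α-last (proj₂ (∈-filter⁻ last? {xs = allFin n} i∈)))

  ⇐ : (∃[ s ] s < n × w ≡ α s) → w ∈ simpleRoots n
  ⇐ (s , s<n , w≡) = subst (_∈ simpleRoots n) (sym w≡)
    (subst (λ s → α s ∈ simpleRoots n) (Fin.toℕ-fromℕ< s<n) (mem (fromℕ< s<n)))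
    where
    mem : (i : Fin n) → α (toℕ i) ∈ simpleRoots n
    mem i with suc (toℕ i) <? n
    ... | yes si<n = ∈-++⁺ˡ (subst (_∈ _) (minus≡α i j (sym j≡))
                       (∈-map⁺ minus (∈-filter⁺ adjacent? (from ∈-pairs (≤-reflexive (sym j≡))) (sym j≡))))
      where
      j : Fin n
      j = fromℕ< si<n
      j≡ : toℕ j ≡ suc (toℕ i)
      j≡ = Fin.toℕ-fromℕ< si<n
    ... | no  si≮n = ∈-++⁺ʳ (map minus (filter adjacent? (pairs n)))
                       (subst (_∈ _) (α-last si≡n) (∈-map⁺ ε (∈-filter⁺ last? (∈-allFin i) si≡n)))
      where
      si≡n : suc (toℕ i) ≡ n
      si≡n = ≤-antisym (Fin.toℕ<n i) (≮⇒≥ si≮n)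

T-== : ∀ {n} {u v : Wt n} → T (u == v) ⇔ u ≡ v
T-== = mk⇔ toWitness fromWitness

T-∈ᵇ : ∀ {n} {w : Wt n} xs → T (w ∈ᵇ xs) ⇔ w ∈ xs
T-∈ᵇ {w = w} xs = mk⇔
  (λ h → let (_ , x∈ , eq) = to (T-any (w ==_) xs) h in subst (_∈ xs) (sym (to T-== eq)) x∈)
  (λ w∈ → from (T-any (w ==_) xs) (w , w∈ , from T-== refl))

-- A simple root has nonnegative prefix sums, so a covering step is a domination of weights.
covers⇒≥ : ∀ {n} (γ μ : Box n) → T (covers (weight γ) (weight μ)) →
           Box.i γ ≤ Box.i μ × Box.c γ ≤ Box.c μ
covers⇒≥ {n} γ μ h with to ∈-simpleRoots (to (T-∈ᵇ (simpleRoots n)) h)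
... | s , s<n , eq = weight-reflects-order μ γ λ {k} k<n →
  ℤ.0≤i-j⇒j≤i (subst (+ 0 ℤ.≤_)
    (trans (cong (λ w → psum w k) (sym eq)) (psum-⊖ (weight γ) (weight μ) k)) (α≥0 k<n))
  where
  α≥0 : ∀ {k} → k < n → + 0 ℤ.≤ psum (α {n} s) k
  α≥0 {k} k<n rewrite psum-⊖ (e {n} s) (e (suc s)) k | psum-e {n} s k<n | psum-e {n} (suc s) k<n
    with s ≤? k | suc s ≤? k
  ... | yes p | yes q rewrite step-1 p | step-1 q = ℤ.+≤+ z≤n
  ... | yes p | no  q rewrite step-1 p | step-0 (≰⇒> q) = ℤ.+≤+ z≤n
  ... | no  p | _     rewrite step-0 (≰⇒> p) | step-0 (<-trans (≰⇒> p) (n<1+n s)) = ℤ.+≤+ z≤n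

covers-α : ∀ {n} (γ μ : Box n) s → s < n →
           (∀ {k} → k < n → at (weight γ) k -ℤ at (weight μ) k ≡ χ s k -ℤ χ (suc s) k) →
           T (covers (weight γ) (weight μ))
covers-α {n} γ μ s s<n h = from (T-∈ᵇ (simpleRoots n)) (from ∈-simpleRoots (s , s<n ,
  at-ext λ {k} k<n → trans (at-⊖ (weight γ) (weight μ) k) (trans (h k<n) (sym
    (trans (at-⊖ (e {n} s) (e (suc s)) k) (cong₂ _-ℤ_ (at-e s k<n) (at-e (suc s) k<n)))))))

covers-above : ∀ {n} (γ μ : Box n) → suc (Box.i γ) ≡ Box.i μ → Box.c γ ≡ Box.c μ → T (covers (weight γ) (weight μ))
covers-above {n} γ@(box i c c′ _ _ eq) μ@(box .(suc i) .c d′ _ _ eq′) refl refl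
  with +-cancelˡ-≡ c c′ d′ (trans eq (sym eq′))
... | refl = covers-α γ μ i (Box.i<n γ) λ {k} k<n →
  trans (cong₂ _-ℤ_ (at-weight γ k<n) (at-weight μ k<n)) (cancel (χ i k) (χ (suc i) k) (χ c k) (χ c′ k))
  where
  cancel : ∀ a b x y → ((a +ℤ x) -ℤ y) -ℤ ((b +ℤ x) -ℤ y) ≡ a -ℤ b
  cancel = ℤ-Solver.solve-∀

-- A step in `c` is accompanied by the opposite step in `c′`, but only one of them happens at
-- indices where `e` can be nonzero: `c` if `c < n`, giving `α c`, and `c′` otherwise, giving `α d`.
covers-left : ∀ {n} (γ μ : Box n) → Box.i γ ≡ Box.i μ → suc (Box.c γ) ≡ Box.c μ → T (covers (weight γ) (weight μ))
covers-left {n} γ@(box i c c′ _ _ eq) μ@(box .i .(suc c) d _ _ eq′) refl refl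
  with +-cancelˡ-≡ c c′ (suc d) (trans eq (sym (trans (+-suc c d) eq′)))
... | refl with c <? n
...   | yes c<n = covers-α γ μ c c<n λ {k} k<n →
  trans (cong₂ _-ℤ_ (at-weight γ k<n) (at-weight μ k<n))
        (cancel (χ i k) (χ c k) (χ (suc c) k) (χ-outside k<n n≤d) (χ-outside k<n (m≤n⇒m≤1+n n≤d)))
  where
  n≤d : n ≤ d
  n≤d = m<1+n⇒m≤n (Box.inRange γ c<n)
  cancel : ∀ a x y {z t} → z ≡ + 0 → t ≡ + 0 → ((a +ℤ x) -ℤ t) -ℤ ((a +ℤ y) -ℤ z) ≡ x -ℤ y
  cancel a x y refl refl = lemma a x y
    where
    lemma : ∀ a x y → ((a +ℤ x) -ℤ + 0) -ℤ ((a +ℤ y) -ℤ + 0) ≡ x -ℤ y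
    lemma = ℤ-Solver.solve-∀
...   | no c≮n = covers-α γ μ d (Box.outOfRange γ (≮⇒≥ c≮n)) λ {k} k<n →
  trans (cong₂ _-ℤ_ (at-weight γ k<n) (at-weight μ k<n))
        (cancel (χ i k) (χ d k) (χ (suc d) k) (χ-outside k<n (≮⇒≥ c≮n)) (χ-outside k<n (m≤n⇒m≤1+n (≮⇒≥ c≮n))))
  where
  cancel : ∀ a x y {z t} → z ≡ + 0 → t ≡ + 0 → ((a +ℤ z) -ℤ y) -ℤ ((a +ℤ t) -ℤ x) ≡ x -ℤ y
  cancel a x y refl refl = lemma a x y
    where
    lemma : ∀ a x y → ((a +ℤ + 0) -ℤ y) -ℤ ((a +ℤ + 0) -ℤ x) ≡ x -ℤ y
    lemma = ℤ-Solver.solve-∀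

-- Positions in the root list

lookup-injective : ∀ {A : Set} {xs : List A} → Unique xs → ∀ {s t} → List.lookup xs s ≡ List.lookup xs t → s ≡ t
lookup-injective {xs = _ ∷ xs} (x∉ ∷ u) {Fin.zero}  {Fin.zero}  _  = refl
lookup-injective {xs = _ ∷ xs} (x∉ ∷ u) {Fin.zero}  {Fin.suc t} eq = ⊥-elim (All.lookup x∉ (∈-lookup t) eq)
lookup-injective {xs = _ ∷ xs} (x∉ ∷ u) {Fin.suc s} {Fin.zero}  eq = ⊥-elim (All.lookup x∉ (∈-lookup s) (sym eq))
lookup-injective {xs = _ ∷ xs} (x∉ ∷ u) {Fin.suc s} {Fin.suc t} eq = cong Fin.suc (lookup-injective u eq)

lookup-fromList : ∀ {A : Set} (xs : List A) t → lookup (Vec.fromList xs) t ≡ List.lookup xs t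
lookup-fromList (x ∷ xs) Fin.zero    = refl
lookup-fromList (x ∷ xs) (Fin.suc t) = lookup-fromList xs t

module _ {n : ℕ} where

  root∈ : ∀ t → root n t ∈ posRootsL n
  root∈ t = subst (_∈ _) (sym (lookup-fromList (posRootsL n) t)) (∈-lookup t)

  opaque
    boxAt : Fin (N n) → Box n
    boxAt t = proj₁ (to ∈-posRoots (root∈ t))

    root≡weight : ∀ t → root n t ≡ weight (boxAt t)
    root≡weight t = proj₂ (to ∈-posRoots (root∈ t))

    indexOf : Box n → Fin (N n)
    indexOf β = Any.index (from ∈-posRoots (β , refl))

    root-indexOf : ∀ β → root n (indexOf β) ≡ weight β
    root-indexOf β = trans (lookup-fromList (posRootsL n) (indexOf β))
                           (sym (Any.lookup-index (from ∈-posRoots (β , refl))))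

  index-unique : ∀ {s t} → root n s ≡ root n t → s ≡ t
  index-unique {s} {t} eq = lookup-injective (unique-posRoots n)
    (trans (sym (lookup-fromList (posRootsL n) s)) (trans eq (lookup-fromList (posRootsL n) t)))

  boxAt-indexOf : ∀ β → Box.i (boxAt (indexOf β)) ≡ Box.i β × Box.c (boxAt (indexOf β)) ≡ Box.c β
  boxAt-indexOf β with weight-injective (boxAt (indexOf β)) β (trans (sym (root≡weight (indexOf β))) (root-indexOf β))
  ... | i≡ , c≡ , _ = i≡ , c≡

  indexOf-unique : ∀ β {t} → Box.i β ≡ Box.i (boxAt t) → Box.c β ≡ Box.c (boxAt t) → indexOf β ≡ t
  indexOf-unique β {t} i≡ c≡ =
    index-unique (trans (root-indexOf β) (trans (weight-cong β (boxAt t) i≡ c≡) (sym (root≡weight t))))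

-- Strict partitions

-- A bit vector of length b, read from the highest position down, is the set of parts of a strict
-- partition with parts at most b; row v i is its i-th largest part, or 0.
row : ∀ {b} → Vec Bool b → ℕ → ℕ
row []                  i       = 0
row         (false ∷ v) i       = row v i
row {suc b} (true  ∷ v) zero    = suc b
row         (true  ∷ v) (suc i) = row v i

row≤ : ∀ {b} (v : Vec Bool b) i → row v i ≤ b ∸ i
row≤ []          i       = z≤n
row≤ {suc b} (false ∷ v) i = ≤-trans (row≤ v i) (∸-monoˡ-≤ i (n≤1+n b))
row≤ (true  ∷ v) zero    = ≤-refl
row≤ (true  ∷ v) (suc i) = row≤ v i

-- With `pred` the bound is strict for positive rows and still lets the zeros after the last part
-- repeat.
row-strict : ∀ {b} (v : Vec Bool b) i → row v (suc i) ≤ pred (row v i)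
row-strict []          i       = z≤n
row-strict (false ∷ v) i       = row-strict v i
row-strict (true  ∷ v) zero    = row≤ v 0
row-strict (true  ∷ v) (suc i) = row-strict v i

row-injective : ∀ {b} (v w : Vec Bool b) → (∀ i → row v i ≡ row w i) → v ≡ w
row-injective []          []          h = refl
row-injective (false ∷ v) (false ∷ w) h = cong (false ∷_) (row-injective v w h)
row-injective (true  ∷ v) (true  ∷ w) h = cong (true ∷_) (row-injective v w (h ∘ suc))
row-injective (false ∷ v) (true  ∷ w) h = ⊥-elim (<⇒≢ (s≤s (row≤ v 0)) (h 0))
row-injective (true  ∷ v) (false ∷ w) h = ⊥-elim (<⇒≢ (s≤s (row≤ w 0)) (sym (h 0)))

-- Deletes the largest part; the remaining ones are smaller and so fit into one bit less.
tl : ∀ {b} → Vec Bool (suc b) → Vec Bool b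
tl         (true  ∷ v) = v
tl {zero}  (false ∷ v) = []
tl {suc b} (false ∷ v) = false ∷ tl v

row-tl : ∀ {b} (v : Vec Bool (suc b)) i → row (tl v) i ≡ row v (suc i)
row-tl         (true  ∷ v)  i = refl
row-tl {zero}  (false ∷ []) i = refl
row-tl {suc b} (false ∷ v)  i = row-tl v i

-- down v and up v move one part of v by one position; a part 1 may be deleted or inserted.
lower raise : ∀ {b} → Vec Bool b → List (Vec Bool (suc b))
lower []          = (false ∷ []) ∷ []
lower (true  ∷ v) = []
lower (false ∷ v) = (false ∷ true ∷ v) ∷ []
raise []          = (true ∷ []) ∷ []
raise (true  ∷ v) = (true ∷ false ∷ v) ∷ []
raise (false ∷ v) = []

down up : ∀ {b} → Vec Bool b → List (Vec Bool b)
down []          = []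
down (false ∷ v) = map (false ∷_) (down v)
down (true  ∷ v) = lower v ++ map (true ∷_) (down v)
up []          = []
up (false ∷ v) = raise v ++ map (false ∷_) (up v)
up (true  ∷ v) = map (true ∷_) (up v)

lower-raise : ∀ {b} (v w : Vec Bool b) → (false ∷ w) ∈ lower v ⇔ (true ∷ v) ∈ raise w
lower-raise []          []          = mk⇔ (λ _ → here refl) (λ _ → here refl)
lower-raise (true  ∷ v) (true  ∷ w) = mk⇔ (λ ()) λ { (here ()) ; (there ()) }
lower-raise (true  ∷ v) (false ∷ w) = mk⇔ (λ ()) (λ ())
lower-raise (false ∷ v) (true  ∷ w) = mk⇔ (λ { (here refl) → here refl }) (λ { (here refl) → here refl })
lower-raise (false ∷ v) (false ∷ w) = mk⇔ (λ { (here ()) ; (there ()) }) (λ ())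

true∉lower : ∀ {b} (v : Vec Bool b) {w} → ¬ (true ∷ w) ∈ lower v
true∉lower []          (here ())
true∉lower (false ∷ v) (here ())

false∉raise : ∀ {b} (v : Vec Bool b) {w} → ¬ (false ∷ w) ∈ raise v
false∉raise []         (here ())
false∉raise (true ∷ v) (here ())

unique-lower : ∀ {b} (v : Vec Bool b) → Unique (lower v)
unique-lower []          = [] ∷ []
unique-lower (true  ∷ v) = []
unique-lower (false ∷ v) = [] ∷ []

unique-raise : ∀ {b} (v : Vec Bool b) → Unique (raise v)
unique-raise []          = [] ∷ []
unique-raise (true  ∷ v) = [] ∷ []
unique-raise (false ∷ v) = []

∈-∷ : ∀ {b x} {v : Vec Bool b} {vs} → (x ∷ v) ∈ map (x ∷_) vs ⇔ v ∈ vs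
∈-∷ = mk⇔ (λ h → let (w , w∈ , eq) = ∈-map⁻ (_ ∷_) h in subst (_∈ _) (sym (Vec.∷-injectiveʳ eq)) w∈) (∈-map⁺ (_ ∷_))

∉-∷ : ∀ {b x y} {v : Vec Bool b} {vs} → ¬ x ≡ y → ¬ (x ∷ v) ∈ map (y ∷_) vs
∉-∷ x≢y h with ∈-map⁻ (_ ∷_) h
... | _ , _ , refl = x≢y refl

∈-down⇔∈-up : ∀ {b} (v w : Vec Bool b) → w ∈ down v ⇔ v ∈ up w
∈-down⇔∈-up []          []          = mk⇔ (λ ()) (λ ())
∈-down⇔∈-up (false ∷ v) (true  ∷ w) =
  mk⇔ (⊥-elim ∘ ∉-∷ λ ()) (⊥-elim ∘ ∉-∷ λ ())
∈-down⇔∈-up (false ∷ v) (false ∷ w) = mk⇔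
  (λ h → ∈-++⁺ʳ (raise w) (∈-map⁺ (false ∷_) (to (∈-down⇔∈-up v w) (to ∈-∷ h))))
  λ h → [ ⊥-elim ∘ false∉raise w , (λ h → from ∈-∷ (from (∈-down⇔∈-up v w) (to ∈-∷ h))) ]′ (∈-++⁻ (raise w) h)
∈-down⇔∈-up (true ∷ v) (true ∷ w) = mk⇔
  (λ h → [ ⊥-elim ∘ true∉lower v , (λ h → from ∈-∷ (to (∈-down⇔∈-up v w) (to ∈-∷ h))) ]′ (∈-++⁻ (lower v) h))
  (λ h → ∈-++⁺ʳ (lower v) (∈-map⁺ (true ∷_) (from (∈-down⇔∈-up v w) (to ∈-∷ h))))
∈-down⇔∈-up (true ∷ v) (false ∷ w) = mk⇔
  (λ h → [ ∈-++⁺ˡ ∘ to (lower-raise v w) , ⊥-elim ∘ ∉-∷ (λ ()) ]′ (∈-++⁻ (lower v) h))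
  (λ h → [ ∈-++⁺ˡ ∘ from (lower-raise v w) , ⊥-elim ∘ ∉-∷ (λ ()) ]′ (∈-++⁻ (raise w) h))

unique-down : ∀ {b} (v : Vec Bool b) → Unique (down v)
unique-down []          = []
unique-down (false ∷ v) = Unique.map⁺ Vec.∷-injectiveʳ (unique-down v)
unique-down (true  ∷ v) = Unique.++⁺ (unique-lower v) (Unique.map⁺ Vec.∷-injectiveʳ (unique-down v)) λ (w∈ , w∈′) →
  let (_ , _ , eq) = ∈-map⁻ (true ∷_) w∈′ in true∉lower v (subst (_∈ lower v) eq w∈)

unique-up : ∀ {b} (v : Vec Bool b) → Unique (up v)
unique-up []          = []
unique-up (true  ∷ v) = Unique.map⁺ Vec.∷-injectiveʳ (unique-up v)
unique-up (false ∷ v) = Unique.++⁺ (unique-raise v) (Unique.map⁺ Vec.∷-injectiveʳ (unique-up v)) λ (w∈ , w∈′) →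
  let (_ , _ , eq) = ∈-map⁻ (false ∷_) w∈′ in false∉raise v (subst (_∈ raise v) eq w∈)

Pred≡At : (ℕ → ℕ) → (ℕ → ℕ) → Set
Pred≡At f g = ∃[ i ] f i ≡ suc (g i) × (∀ j → ¬ j ≡ i → f j ≡ g j)

down-row : ∀ {b} (v : Vec Bool b) {w} → w ∈ down v → Pred≡At (row v) (row w)
down-row (false ∷ v) w∈ with ∈-map⁻ (false ∷_) w∈
... | w′ , w′∈ , refl = down-row v w′∈
down-row {suc b} (true ∷ v) w∈ with ∈-++⁻ (lower v) w∈
... | inj₂ w∈′ with ∈-map⁻ (true ∷_) w∈′
...   | w′ , w′∈ , refl with down-row v w′∈
...     | i , eq , rest = suc i , eq , λ { zero _ → refl ; (suc j) j≢ → rest j (j≢ ∘ cong suc) }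
down-row (true ∷ []) _ | inj₁ (here refl) = 0 , refl , λ { zero j≢ → ⊥-elim (j≢ refl) ; (suc j) _ → refl }
down-row (true ∷ false ∷ v) _ | inj₁ (here refl) = 0 , refl , λ { zero j≢ → ⊥-elim (j≢ refl) ; (suc j) _ → refl }

_≼_ : ∀ {b} → Vec Bool b → Vec Bool b → Set
v ≼ w = ∀ i → row v i ≤ row w i

-- The largest part of `v` is lowered only when the other parts already agree with those of `w`
-- below its largest. If `w` lacks that top part, its own largest part is at most `b`, so its tail
-- leaves the next position free and the top part of `v` can move there.
≡-or-below : ∀ {b} (w v : Vec Bool b) → w ≼ v → w ≡ v ⊎ (∃[ z ] z ∈ down v × w ≼ z)
≡-or-below []          []          h = inj₁ refl
≡-or-below (true  ∷ w) (false ∷ v) h = ⊥-elim (<-irrefl refl (≤-trans (h 0) (row≤ v 0)))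
≡-or-below (false ∷ w) (false ∷ v) h with ≡-or-below w v h
... | inj₁ refl            = inj₁ refl
... | inj₂ (z , z∈ , w≼z) = inj₂ (false ∷ z , ∈-map⁺ (false ∷_) z∈ , w≼z)
≡-or-below {suc b} w (true ∷ v) h with ≡-or-below (tl w) v (λ i → subst (_≤ row v i) (sym (row-tl w i)) (h (suc i)))
... | inj₂ (z , z∈ , w≼z) = inj₂ (true ∷ z , ∈-++⁺ʳ (lower v) (∈-map⁺ (true ∷_) z∈) , λ
        { zero    → row≤ w 0
        ; (suc i) → subst (_≤ row z i) (row-tl w i) (w≼z i) })
≡-or-below         (true  ∷ w)  (true ∷ v) h | inj₁ refl = inj₁ refl
≡-or-below {suc b} (false ∷ w)  (true ∷ v) h | inj₁ refl = inj₂ (shift v refl)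
  where
  shift : ∀ v → v ≡ tl (false ∷ w) → ∃[ z ] z ∈ down (true ∷ v) × (false ∷ w) ≼ z
  shift [] eq = false ∷ [] , here refl , λ i → subst (row w i ≤_) (0∸n≡0 i) (row≤ w i)
  shift (true ∷ v) ()
  shift (false ∷ v) eq = false ∷ true ∷ v , here refl , λ
    { zero    → row≤ w 0
    ; (suc i) → ≤-reflexive (trans (sym (row-tl (false ∷ w) i)) (cong (λ u → row u i) (sym eq))) }

-- Counting

Σᵛ : ∀ b → (Vec Bool b → ℕ) → ℕ
Σᵛ zero    f = f []
Σᵛ (suc b) f = Σᵛ b (f ∘ (false ∷_)) + Σᵛ b (f ∘ (true ∷_))

Σᵛ-cong : ∀ b {f g} → (∀ v → f v ≡ g v) → Σᵛ b f ≡ Σᵛ b g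
Σᵛ-cong zero    h = h []
Σᵛ-cong (suc b) h = cong₂ _+_ (Σᵛ-cong b (h ∘ (false ∷_))) (Σᵛ-cong b (h ∘ (true ∷_)))

Σᵛ-0 : ∀ b → Σᵛ b (λ _ → 0) ≡ 0
Σᵛ-0 zero    = refl
Σᵛ-0 (suc b) = cong₂ _+_ (Σᵛ-0 b) (Σᵛ-0 b)

+-exchange : ∀ a b c d → (a + b) + (c + d) ≡ (a + c) + (b + d)
+-exchange = solve-∀

Σᵛ-+ : ∀ b f g → Σᵛ b (λ v → f v + g v) ≡ Σᵛ b f + Σᵛ b g
Σᵛ-+ zero    f g = refl
Σᵛ-+ (suc b) f g = trans (cong₂ _+_ (Σᵛ-+ b _ _) (Σᵛ-+ b _ _))
                         (+-exchange (Σᵛ b (f ∘ (false ∷_))) _ (Σᵛ b (f ∘ (true ∷_))) _)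

Σᵛ-2* : ∀ b f → Σᵛ b (λ v → 2 * f v) ≡ 2 * Σᵛ b f
Σᵛ-2* zero    f = refl
Σᵛ-2* (suc b) f = trans (cong₂ _+_ (Σᵛ-2* b _) (Σᵛ-2* b _)) (sym (*-distribˡ-+ 2 (Σᵛ b (f ∘ (false ∷_))) _))

count-concatMap : ∀ {A B : Set} (p : B → Bool) (f : A → List B) {g : A → List B} xs →
                  (∀ x → count p (f x) ≡ count p (g x)) → count p (concatMap f xs) ≡ count p (concatMap g xs)
count-concatMap p f [] h = refl
count-concatMap p f {g} (x ∷ xs) h
  rewrite count-++ p (f x) (concatMap f xs) | count-++ p (g x) (concatMap g xs) =
  cong₂ _+_ (h x) (count-concatMap p f xs h)

concatMap-concatMap : ∀ {A B C : Set} (f : A → List B) (g : B → List C) xs →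
                      concatMap g (concatMap f xs) ≡ concatMap (concatMap g ∘ f) xs
concatMap-concatMap f g [] = refl
concatMap-concatMap f g (x ∷ xs) = trans (List.concatMap-++ g (f x) (concatMap f xs))
                                         (cong (concatMap g (f x) ++_) (concatMap-concatMap f g xs))

-- The list alternates the top bit while `Σᵛ` splits on it. Since `f` may return any list, the two
-- entries over one `v` can be merged and the induction applied to the merged function.
count-allSubsets : ∀ {A : Set} (p : A → Bool) b (f : Vec Bool b → List A) →
                   count p (concatMap f (allSubsets b)) ≡ Σᵛ b (count p ∘ f)
count-allSubsets p zero f = cong (count p) (List.++-identityʳ (f []))
count-allSubsets p (suc b) f = begin
  count p (concatMap f (allSubsets (suc b)))
    ≡⟨ cong (count p) (concatMap-concatMap _ f (allSubsets b)) ⟩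
  count p (concatMap (λ v → f (false ∷ v) ++ (f (true ∷ v) ++ [])) (allSubsets b))
    ≡⟨ count-allSubsets p b _ ⟩
  Σᵛ b (λ v → count p (f (false ∷ v) ++ (f (true ∷ v) ++ [])))
    ≡⟨ Σᵛ-cong b (λ v → trans (cong (λ l → count p (f (false ∷ v) ++ l)) (List.++-identityʳ (f (true ∷ v))))
                              (count-++ p (f (false ∷ v)) (f (true ∷ v)))) ⟩
  Σᵛ b (λ v → count p (f (false ∷ v)) + count p (f (true ∷ v)))
    ≡⟨ Σᵛ-+ b _ _ ⟩
  Σᵛ (suc b) (count p ∘ f) ∎
  where open ≡-Reasoning

unique-allSubsets : ∀ b → Unique (allSubsets b)
unique-allSubsets zero    = [] ∷ []
unique-allSubsets (suc b) = unique-concatMap Vec.tail (unique-allSubsets b)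
  (λ v → ((λ ()) ∷ []) ∷ [] ∷ []) (λ { v (here refl) → refl ; v (there (here refl)) → refl })

∈-allSubsets : ∀ {b} (v : Vec Bool b) → v ∈ allSubsets b
∈-allSubsets []          = here refl
∈-allSubsets (false ∷ v) = from ∈-concatMap (v , ∈-allSubsets v , here refl)
∈-allSubsets (true  ∷ v) = from ∈-concatMap (v , ∈-allSubsets v , there (here refl))

δ : ℕ → ℕ → ℕ
δ i k = if i ≡ᵇ k then 1 else 0

C⁻ : ℕ → ℕ → ℕ
C⁻ n zero    = 0
C⁻ n (suc m) = n C m

pascal : ∀ n m → suc n C m ≡ n C m + C⁻ n m
pascal n zero    = refl
pascal n (suc m) = trans (sym (nCk+nC[k+1]≡[n+1]C[k+1] n m)) (+-comm (n C m) _)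

-- Unlike `2 * suc k`, this reduces to two successors, the form in which Pascal's rule is applied.
dbl : ℕ → ℕ
dbl zero    = zero
dbl (suc k) = suc (suc (dbl k))

dbl≡2* : ∀ k → dbl k ≡ 2 * k
dbl≡2* zero    = refl
dbl≡2* (suc k) = trans (cong (suc ∘ suc) (dbl≡2* k)) (sym (*-suc 2 k))

-- A b k and B b k stand for the numbers of v of length b such that v, respectively v with a further
-- top bit, has k lower (or upper) neighbours.
module Distribution (A B : ℕ → ℕ → ℕ)
  (A₀ : ∀ k → A 0 k ≡ δ 0 k) (B₀ : ∀ k → B 0 k ≡ δ 1 k)
  (A₊ : ∀ b k → A (suc b) k ≡ A b k + B b k)
  (B₊₀ : ∀ b → B (suc b) 0 ≡ B b 0) (B₊ : ∀ b k → B (suc b) (suc k) ≡ A b k + B b (suc k)) where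

  -- The odd index in `B` arises because a further top bit belonging to a run fixes the uppermost
  -- cut point, which leaves `2k − 1` to be chosen among the `b + 1` below it.
  closed : ∀ b → (∀ k → A b k ≡ suc b C (dbl k)) × (∀ k → B b k ≡ C⁻ (suc b) (dbl k))
  closed zero = A0 , B0
    where
    A0 : ∀ k → A 0 k ≡ 1 C (dbl k)
    A0 zero    = A₀ 0
    A0 (suc k) = A₀ (suc k)
    B0 : ∀ k → B 0 k ≡ C⁻ 1 (dbl k)
    B0 zero          = B₀ 0
    B0 (suc zero)    = B₀ 1
    B0 (suc (suc k)) = B₀ (suc (suc k))
  closed (suc b) with closed b
  ... | hA , hB = (λ k → trans (A₊ b k) (trans (cong₂ _+_ (hA k) (hB k)) (sym (pascal (suc b) (dbl k))))) , B1
    where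
    B1 : ∀ k → B (suc b) k ≡ C⁻ (suc (suc b)) (dbl k)
    B1 zero    = trans (B₊₀ b) (hB 0)
    B1 (suc k) = trans (B₊ b k) (trans (cong₂ _+_ (hA k) (hB (suc k))) eq)
      where
      eq : suc b C (dbl k) + C⁻ (suc b) (dbl (suc k)) ≡ C⁻ (suc (suc b)) (dbl (suc k))
      eq = nCk+nC[k+1]≡[n+1]C[k+1] (suc b) (dbl k)

#down #up : ∀ {b} → Vec Bool b → ℕ
#down = length ∘ down
#up   = length ∘ up

#map : ∀ {b x} (vs : List (Vec Bool b)) → length (map (x ∷_) vs) ≡ length vs
#map = List.length-map _

-- A one above a zero is a run by itself and contributes a move; above another one, as in
-- `#down-11`, it only lengthens a run.
#down-10 : ∀ {b} (v : Vec Bool b) → #down (true ∷ false ∷ v) ≡ suc (#down v)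
#down-10 v = cong suc (trans (#map (map (false ∷_) (down v))) (#map (down v)))

#down-11 : ∀ {b} (v : Vec Bool b) → #down (true ∷ true ∷ v) ≡ #down (true ∷ v)
#down-11 v = #map (down (true ∷ v))

#up-00 : ∀ {b} (v : Vec Bool b) → #up (false ∷ false ∷ v) ≡ #up (false ∷ v)
#up-00 v = #map (up (false ∷ v))

#up-01 : ∀ {b} (v : Vec Bool b) → #up (false ∷ true ∷ v) ≡ suc (#up v)
#up-01 v = cong suc (trans (#map (map (true ∷_) (up v))) (#map (up v)))

opaque
  Σδ : ∀ b → (Vec Bool b → ℕ) → ℕ → ℕ
  Σδ b f k = Σᵛ b (λ v → δ (f v) k)

  Σδ-zero : ∀ f k → Σδ 0 f k ≡ δ (f []) k
  Σδ-zero f k = refl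

  Σδ-suc : ∀ b {f} g h → (∀ v → f (false ∷ v) ≡ g v) → (∀ v → f (true ∷ v) ≡ h v) →
           ∀ k → Σδ (suc b) f k ≡ Σδ b g k + Σδ b h k
  Σδ-suc b g h eg eh k = cong₂ _+_ (Σᵛ-cong b (λ v → cong (λ x → δ x k) (eg v)))
                                   (Σᵛ-cong b (λ v → cong (λ x → δ x k) (eh v)))

  Σδ-shift : ∀ b f k → Σδ b (suc ∘ f) (suc k) ≡ Σδ b f k
  Σδ-shift b f k = refl

  Σδ-shift₀ : ∀ b f → Σδ b (suc ∘ f) 0 ≡ 0
  Σδ-shift₀ b f = Σᵛ-0 b

  Σδ≡ : ∀ b f k → Σᵛ b (λ v → δ (f v) k) ≡ Σδ b f k
  Σδ≡ b f k = refl

module Down = Distribution (λ b → Σδ b #down) (λ b → Σδ b (#down ∘ (true ∷_)))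
  (Σδ-zero #down) (Σδ-zero (#down ∘ (true ∷_)))
  (λ b → Σδ-suc b #down (#down ∘ (true ∷_)) (λ v → #map (down v)) (λ _ → refl))
  (λ b → trans (Σδ-suc b (suc ∘ #down) (#down ∘ (true ∷_)) #down-10 #down-11 0)
               (cong (λ x → x + Σδ b (#down ∘ (true ∷_)) 0) (Σδ-shift₀ b #down)))
  (λ b k → trans (Σδ-suc b (suc ∘ #down) (#down ∘ (true ∷_)) #down-10 #down-11 (suc k))
                 (cong (λ x → x + Σδ b (#down ∘ (true ∷_)) (suc k)) (Σδ-shift b #down k)))

module Up = Distribution (λ b → Σδ b #up) (λ b → Σδ b (#up ∘ (false ∷_)))
  (Σδ-zero #up) (Σδ-zero (#up ∘ (false ∷_)))
  (λ b k → trans (Σδ-suc b (#up ∘ (false ∷_)) #up (λ _ → refl) (λ v → #map (up v)) k)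
                 (+-comm (Σδ b (#up ∘ (false ∷_)) k) _))
  (λ b → trans (Σδ-suc b (#up ∘ (false ∷_)) (suc ∘ #up) #up-00 #up-01 0)
               (trans (cong (λ x → Σδ b (#up ∘ (false ∷_)) 0 + x) (Σδ-shift₀ b #up)) (+-identityʳ _)))
  (λ b k → trans (Σδ-suc b (#up ∘ (false ∷_)) (suc ∘ #up) #up-00 #up-01 (suc k))
                 (trans (+-comm (Σδ b (#up ∘ (false ∷_)) (suc k)) _)
                        (cong (λ x → x + Σδ b (#up ∘ (false ∷_)) (suc k)) (Σδ-shift b #up k))))

-- The upward moves of v other than the one of its largest part (or, for v = 0, of the insertion of 1).
#inner : ∀ {b} → Vec Bool b → ℕ
#inner []          = 0
#inner (false ∷ v) = #inner v
#inner (true  ∷ v) = #up v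

-- The cut point above the largest part (the bottom one for the zero vector) joins the `2k` cut
-- points that bound the runs of zeros below that part, hence an odd lower index.
inner-closed : ∀ b k → Σδ b #inner k ≡ suc b C suc (dbl k)
inner-closed zero zero    = Σδ-zero #inner 0
inner-closed zero (suc k) = Σδ-zero #inner (suc k)
inner-closed (suc b) k = trans (Σδ-suc b #inner #up (λ _ → refl) (λ _ → refl) k)
  (trans (cong₂ _+_ (inner-closed b k) (proj₁ (Up.closed b) k)) (sym (pascal (suc b) (suc (dbl k)))))

-- The number of a for which the ideal with first row a and other rows v has κ = k, respectively ι = k.
κstat ιstat : ∀ {b} → ℕ → Vec Bool b → ℕ
κstat k []          = δ 0 k + 3 * δ 1 k
κstat k (false ∷ v) = κstat k v + 2 * δ (suc (#down v)) k
κstat k (true  ∷ v) = δ (#down (true ∷ v)) k + δ (suc (#down (true ∷ v))) k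
ιstat k []          = δ 0 k + 3 * δ 1 k
ιstat k (false ∷ v) = ιstat k v + 2 * δ (suc (suc (#inner v))) k
ιstat k (true  ∷ v) = δ (#up v) k + δ (suc (#up v)) k

Σκstat-suc : ∀ b k → Σᵛ (suc b) (κstat k) ≡
  (Σᵛ b (κstat k) + 2 * Σδ b (suc ∘ #down) k) + (Σδ b (#down ∘ (true ∷_)) k + Σδ b (suc ∘ #down ∘ (true ∷_)) k)
Σκstat-suc b k = cong₂ _+_
  (trans (Σᵛ-+ b (κstat k) _) (cong (λ x → Σᵛ b (κstat k) + x)
    (trans (Σᵛ-2* b _) (cong (2 *_) (Σδ≡ b (suc ∘ #down) k)))))
  (trans (Σᵛ-+ b _ _) (cong₂ _+_ (Σδ≡ b (#down ∘ (true ∷_)) k) (Σδ≡ b (suc ∘ #down ∘ (true ∷_)) k)))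

Σιstat-suc : ∀ b k → Σᵛ (suc b) (ιstat k) ≡
  (Σᵛ b (ιstat k) + 2 * Σδ b (suc ∘ suc ∘ #inner) k) + (Σδ b #up k + Σδ b (suc ∘ #up) k)
Σιstat-suc b k = cong₂ _+_
  (trans (Σᵛ-+ b (ιstat k) _) (cong (λ x → Σᵛ b (ιstat k) + x)
    (trans (Σᵛ-2* b _) (cong (2 *_) (Σδ≡ b (suc ∘ suc ∘ #inner) k)))))
  (trans (Σᵛ-+ b _ _) (cong₂ _+_ (Σδ≡ b #up k) (Σδ≡ b (suc ∘ #up) k)))

-- The increment in `b` is a sum of the shape `y + 2x + z` of three neighbouring binomials in row
-- `b + 1`, which Pascal's rule applied twice collects into `(3 + b) C (2k − 1)`.
κstat-closed : ∀ b k → Σᵛ b (κstat k) ≡ (3 + b) C (dbl k)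
κstat-closed zero zero          = refl
κstat-closed zero (suc zero)    = refl
κstat-closed zero (suc (suc k)) = refl
κstat-closed (suc b) zero
  rewrite Σκstat-suc b 0 | κstat-closed b 0 | Σδ-shift₀ b #down | Σδ-shift₀ b (#down ∘ (true ∷_))
        | proj₂ (Down.closed b) 0 = refl
κstat-closed (suc b) (suc k)
  rewrite Σκstat-suc b (suc k) | κstat-closed b (suc k) | Σδ-shift b #down k | Σδ-shift b (#down ∘ (true ∷_)) k
        | proj₁ (Down.closed b) k | proj₂ (Down.closed b) (suc k) | proj₂ (Down.closed b) k
        | pascal (3 + b) (2 + dbl k) | pascal (2 + b) (1 + dbl k) | pascal (1 + b) (1 + dbl k)
        | pascal (1 + b) (dbl k) =
  shuffle (suc (suc (suc b)) C suc (suc (dbl k))) (suc b C (dbl k)) (suc b C suc (dbl k)) (C⁻ (suc b) (dbl k))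
  where
  shuffle : ∀ w x y z → (w + 2 * x) + (y + z) ≡ w + ((y + x) + (x + z))
  shuffle = solve-∀

-- The coefficient in (ii) for `n = 2 + b`. At `k = 0` the truncation of `pred` is harmless, since
-- `C⁻` is 0 there.
ιclosed : ℕ → ℕ → ℕ
ιclosed b k = suc b C suc (dbl k) + C⁻ (2 + b) (dbl k) + C⁻ (suc b) (pred (dbl k))

-- By Pascal's rule the three terms of `ιclosed` grow by `(b + 1) C 2k`, `(b + 2) C (2k − 2)` and
-- `(b + 1) C (2k − 3)`; splitting the second once more gives exactly the new contributions. The
-- values `k = 0` and `k = 1` stand apart because `#inner` enters shifted by two.
ιstat-closed : ∀ b k → Σᵛ b (ιstat k) ≡ ιclosed b k
ιstat-closed zero zero          = refl
ιstat-closed zero (suc zero)    = refl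
ιstat-closed zero (suc (suc k)) = refl
ιstat-closed (suc b) zero
  rewrite Σιstat-suc b 0 | ιstat-closed b 0 | Σδ-shift₀ b (suc ∘ #inner) | Σδ-shift₀ b #up
        | proj₁ (Up.closed b) 0 | pascal (suc b) 1 = shuffle (suc b C 1)
  where
  shuffle : ∀ x → ((x + 0 + 0) + 0) + 1 ≡ ((x + 1) + 0) + 0
  shuffle = solve-∀
ιstat-closed (suc b) (suc zero)
  rewrite Σιstat-suc b 1 | ιstat-closed b 1 | Σδ-shift b (suc ∘ #inner) 0 | Σδ-shift₀ b #inner | Σδ-shift b #up 0
        | proj₁ (Up.closed b) 0 | proj₁ (Up.closed b) 1 | pascal (suc b) 3 | pascal (2 + b) 1 =
  shuffle (suc b C 3) (suc (suc b) C 1) (suc b C 2)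
  where
  shuffle : ∀ x y z → ((x + y + 1) + 0) + (z + 1) ≡ (x + z) + (y + 1) + 1
  shuffle = solve-∀
ιstat-closed (suc b) (suc (suc k))
  rewrite Σιstat-suc b (2 + k) | ιstat-closed b (2 + k) | Σδ-shift b (suc ∘ #inner) (suc k) | Σδ-shift b #inner k
        | Σδ-shift b #up (suc k) | inner-closed b k
        | proj₁ (Up.closed b) (suc k) | proj₁ (Up.closed b) (2 + k)
        | pascal (suc b) (5 + dbl k) | pascal (2 + b) (3 + dbl k) | pascal (1 + b) (2 + dbl k) =
  shuffle (suc b C (5 + dbl k)) (suc (suc b) C (3 + dbl k)) (suc b C (2 + dbl k)) (suc b C (1 + dbl k))
          (suc b C (4 + dbl k))
  where
  shuffle : ∀ v w x y z → ((v + w + x) + 2 * y) + (z + x) ≡ (v + z) + (w + (x + y)) + (x + y)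
  shuffle = solve-∀

-- A code (a , v) stands for the ideal of type B with n = 2 + b whose first row has length a and whose
-- other rows are given by v. With m the length of the second row, the abelian ideals are those with
-- m < a ≤ 2n − 2 − m and, if m = 0, also those with a = 0 or a = 2n − 1.
Valid : ℕ → ℕ → ℕ → Set
Valid b a m = (m < a × a + m ≤ 2 + (b + b)) ⊎ (m ≡ 0 × (a ≡ 0 ⊎ a ≡ 3 + (b + b)))

valid? : ∀ b a m → Dec (Valid b a m)
valid? b a m = (m <? a ×-dec a + m ≤? 2 + (b + b)) ⊎-dec (m ≟ 0 ×-dec (a ≟ 0 ⊎-dec a ≟ 3 + (b + b)))

Code : ℕ → Set
Code b = ℕ × Vec Bool b

Ok : ∀ {b} → Code b → Set
Ok {b} (a , v) = Valid b a (row v 0)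

ok? : ∀ {b} (x : Code b) → Dec (Ok x)
ok? {b} (a , v) = valid? b a (row v 0)

gap : ∀ {b} → Vec Bool b → ℕ
gap []          = 0
gap (false ∷ v) = suc (gap v)
gap (true  ∷ v) = 0

row+gap : ∀ {b} (v : Vec Bool b) → row v 0 + gap v ≡ b
row+gap []          = refl
row+gap (false ∷ v) = trans (+-suc (row v 0) (gap v)) (cong suc (row+gap v))
row+gap (true  ∷ v) = +-identityʳ _

-- With `m = row v 0`, `g = gap v` and `m + g = b`, the condition `m < a ≤ 2 + 2b − m` leaves
-- `2 + 2g` values of `a`. For `m = 0` one has `g = b`, so `3 + (g + g)` is the full first row, of
-- length `2n − 1`.
core extra range : ℕ → ℕ → List ℕ
core m g = map (λ j → suc (m + j)) (upTo (2 + (g + g)))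
extra zero    g = 0 ∷ 3 + (g + g) ∷ []
extra (suc m) g = []
range m g = extra m g ++ core m g

∈-core : ∀ m g {a} → a ∈ core m g ⇔ (m < a × a + m ≤ 2 + ((m + g) + (m + g)))
∈-core m g {a} = mk⇔ ⇒ ⇐
  where
  shift : ∀ j → suc (m + j) + m ≡ suc (m + m + j)
  shift = shift′ m
    where
    shift′ : ∀ m j → suc (m + j) + m ≡ suc (m + m + j)
    shift′ = solve-∀

  top : 2 + ((m + g) + (m + g)) ≡ m + m + (2 + (g + g))
  top = top′ m g
    where
    top′ : ∀ m g → 2 + ((m + g) + (m + g)) ≡ m + m + (2 + (g + g))
    top′ = solve-∀

  ⇒ : a ∈ core m g → m < a × a + m ≤ 2 + ((m + g) + (m + g))
  ⇒ h = let (j , j∈ , a≡) = ∈-map⁻ _ h in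
    subst (m <_) (sym a≡) (s≤s (m≤m+n m j)) ,
    subst₂ _≤_ (sym (trans (cong (_+ m) a≡) (shift j))) (sym top) (+-monoʳ-< (m + m) (∈-upTo⁻ j∈))

  ⇐ : m < a × a + m ≤ 2 + ((m + g) + (m + g)) → a ∈ core m g
  ⇐ (m<a , a+m≤) = subst (_∈ core m g) (m+[n∸m]≡n m<a) (∈-map⁺ _ (∈-upTo⁺
    (+-cancelˡ-< (m + m) _ _
      (subst₂ _≤_ (trans (cong (_+ m) (sym (m+[n∸m]≡n m<a))) (shift (a ∸ suc m))) top a+m≤))))

∈-range : ∀ m g {b a} → m + g ≡ b → a ∈ range m g ⇔ Valid b a m
∈-range m g {a = a} refl = mk⇔ (⇒ m) (⇐ m)
  where
  ⇒ : ∀ m → a ∈ range m g → Valid (m + g) a m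
  ⇒ zero    (here eq)              = inj₂ (refl , inj₁ eq)
  ⇒ zero    (there (here eq))      = inj₂ (refl , inj₂ eq)
  ⇒ zero    (there (there a∈core)) = inj₁ (to (∈-core zero g) a∈core)
  ⇒ (suc m) a∈core                 = inj₁ (to (∈-core (suc m) g) a∈core)

  ⇐ : ∀ m → Valid (m + g) a m → a ∈ range m g
  ⇐ m (inj₁ h)                    = ∈-++⁺ʳ (extra m g) (from (∈-core m g) h)
  ⇐ zero (inj₂ (_ , inj₁ eq))     = here eq
  ⇐ zero (inj₂ (_ , inj₂ eq))     = there (here eq)

unique-range : ∀ m g → Unique (range m g)
unique-range m g = Unique.++⁺ (unique-extra m) unique-core (disjoint m)
  where
  unique-core : ∀ {m} → Unique (core m g)
  unique-core {m} = Unique.map⁺ (λ eq → +-cancelˡ-≡ (suc m) _ _ eq) (Unique.upTo⁺ (2 + (g + g)))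

  unique-extra : ∀ m → Unique (extra m g)
  unique-extra zero    = ((λ ()) ∷ []) ∷ [] ∷ []
  unique-extra (suc m) = []

  disjoint : ∀ m {a} → ¬ (a ∈ extra m g × a ∈ core m g)
  disjoint zero (here refl , a∈) with to (∈-core zero g) a∈
  ... | () , _
  disjoint zero (there (here refl) , a∈) with to (∈-core zero g) a∈
  ... | _ , s≤s (s≤s h) = <-irrefl refl (≤-trans (m≤m+n (suc (g + g)) 0) h)

codes : ∀ b → List (Code b)
codes b = concatMap (λ v → map (_, v) (range (row v 0) (gap v))) (allSubsets b)

∈-codes : ∀ {b} {x : Code b} → x ∈ codes b ⇔ Ok x
∈-codes {b} {a , v} = mk⇔ ⇒ ⇐
  where
  ⇒ : (a , v) ∈ codes b → Ok (a , v)
  ⇒ h with to (∈-concatMap {f = λ v → map (_, v) (range (row v 0) (gap v))} {allSubsets b}) h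
  ... | w , _ , h₁ with ∈-map⁻ (_, w) h₁
  ... | _ , a∈ , refl = to (∈-range (row v 0) (gap v) (row+gap v)) a∈

  ⇐ : Ok (a , v) → (a , v) ∈ codes b
  ⇐ h = from (∈-concatMap {f = λ v → map (_, v) (range (row v 0) (gap v))} {allSubsets b})
    (v , ∈-allSubsets v , ∈-map⁺ (_, v) (from (∈-range (row v 0) (gap v) (row+gap v)) h))

unique-codes : ∀ b → Unique (codes b)
unique-codes b = unique-concatMap proj₂ (unique-allSubsets b)
  (λ v → Unique.map⁺ (cong proj₁) (unique-range (row v 0) (gap v)))
  (λ v y∈ → cong proj₂ (proj₂ (proj₂ (∈-map⁻ (_, v) y∈))))

preds : ℕ → List ℕ
preds zero    = []
preds (suc a) = a ∷ []

downCode upCode : ∀ {b} → Code b → List (Code b)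
downCode (a , v) = filter ok? (map (_, v) (preds a) ++ map (a ,_) (down v))
upCode   (a , v) = filter ok? ((suc a , v) ∷ map (a ,_) (up v))

bit : Bool → ℕ
bit t = if t then 1 else 0

length-filter-∷ : ∀ {A : Set} {P : A → Set} (P? : ∀ x → Dec (P x)) x xs →
                  length (filter P? (x ∷ xs)) ≡ bit (does (P? x)) + length (filter P? xs)
length-filter-∷ P? x xs with does (P? x)
... | true  = refl
... | false = refl

length-filter-map : ∀ {A B : Set} {P : B → Set} (P? : ∀ x → Dec (P x)) (f : A → B) xs →
                    length (filter P? (map f xs)) ≡ length (filter (P? ∘ f) xs)
length-filter-map P? f [] = refl
length-filter-map P? f (x ∷ xs) with does (P? (f x))
... | true  = cong suc (length-filter-map P? f xs)
... | false = length-filter-map P? f xs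

bit-yes : ∀ {P : Set} (P? : Dec P) → P → bit (does P?) ≡ 1
bit-yes (yes _) _ = refl
bit-yes (no ¬p) p = ⊥-elim (¬p p)

bit-no : ∀ {P : Set} (P? : Dec P) → ¬ P → bit (does P?) ≡ 0
bit-no (yes p) ¬p = ⊥-elim (¬p p)
bit-no (no _)  _  = refl

Pred≡At⇒≤ : ∀ {f g} → Pred≡At f g → ∀ i → g i ≤ f i
Pred≡At⇒≤ {f} {g} (i₀ , eq , rest) i with i ≟ i₀
... | yes refl = ≤-trans (n≤1+n _) (≤-reflexive (sym eq))
... | no  i≢   = ≤-reflexive (sym (rest i i≢))

valid-mono : ∀ {b a m m′} → m′ ≤ m → Valid b a m → Valid b a m′
valid-mono {b} {a} m′≤m (inj₁ (m<a , le)) = inj₁ (≤-trans (s≤s m′≤m) m<a , ≤-trans (+-monoʳ-≤ a m′≤m) le)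
valid-mono z≤n (inj₂ (refl , h)) = inj₂ (refl , h)

downBit : ℕ → ℕ → ℕ → ℕ
downBit b a m = length (filter (λ a → valid? b a m) (preds a))

-- Shrinking a lower row preserves validity, so the filter can reject only the move of the first
-- row.
#downCode : ∀ {b} {x : Code b} → Ok x →
            length (downCode x) ≡ downBit b (proj₁ x) (row (proj₂ x) 0) + #down (proj₂ x)
#downCode {b} {a , v} okx = begin
  length (filter ok? (map (_, v) (preds a) ++ map (a ,_) (down v)))
    ≡⟨ cong length (List.filter-++ ok? (map (_, v) (preds a)) _) ⟩
  length (filter ok? (map (_, v) (preds a)) ++ filter ok? (map (a ,_) (down v)))
    ≡⟨ List.length-++ (filter ok? (map (_, v) (preds a))) ⟩
  length (filter ok? (map (_, v) (preds a))) + length (filter ok? (map (a ,_) (down v)))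
    ≡⟨ cong₂ _+_ (length-filter-map ok? (_, v) (preds a))
         (trans (cong length (List.filter-all ok? (All.tabulate allOk))) (List.length-map (a ,_) (down v))) ⟩
  downBit b a (row v 0) + #down v ∎
  where
  open ≡-Reasoning
  allOk : ∀ {y} → y ∈ map (a ,_) (down v) → Ok y
  allOk y∈ with ∈-map⁻ (a ,_) y∈
  ... | w , w∈ , refl = valid-mono {b} {a} (Pred≡At⇒≤ (down-row v w∈) 0) okx

movable : ∀ {b} → Vec Bool b → ℕ
movable []          = 0
movable (false ∷ v) = 1
movable (true  ∷ v) = 0

-- Validity sees `v` only through its largest part. One upward move at most changes that part, and
-- all moves counted by `#inner` pass the test unchanged.
filter-up : ∀ {P : ℕ → Set} (P? : ∀ m → Dec (P m)) {b} (v : Vec Bool b) → P (row v 0) →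
            length (filter (λ w → P? (row w 0)) (up v)) ≡ movable v * bit (does (P? (suc (row v 0)))) + #inner v
filter-up P? [] _ = refl
filter-up P? (true ∷ v) p = trans (length-filter-map (λ w → P? (row w 0)) (true ∷_) (up v))
  (cong length (List.filter-all _ (All.tabulate {xs = up v} (λ _ → p))))
filter-up P? (false ∷ []) p = trans (length-filter-∷ (λ w → P? (row w 0)) (true ∷ []) [])
  (sym (cong (_+ 0) (+-identityʳ _)))
filter-up P? (false ∷ true ∷ v) p =
  trans (length-filter-∷ (λ w → P? (row w 0)) (true ∷ false ∷ v) (map (false ∷_) (up (true ∷ v))))
    (cong₂ _+_ (sym (+-identityʳ _)) (trans (length-filter-map (λ w → P? (row w 0)) (false ∷_) (up (true ∷ v)))
                                            (filter-up P? (true ∷ v) p)))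
filter-up P? (false ∷ false ∷ v) p =
  trans (length-filter-map (λ w → P? (row w 0)) (false ∷_) (up (false ∷ v))) (filter-up P? (false ∷ v) p)

#upCode : ∀ {b} {x : Code b} → Ok x → let (a , v) = x in
  length (upCode x) ≡ bit (does (valid? b (suc a) (row v 0)))
                    + (movable v * bit (does (valid? b a (suc (row v 0)))) + #inner v)
#upCode {b} {a , v} okx = trans (length-filter-∷ ok? (suc a , v) (map (a ,_) (up v)))
  (cong (λ l → bit (does (valid? b (suc a) (row v 0))) + l)
    (trans (length-filter-map ok? (a ,_) (up v)) (filter-up (valid? b a) v okx)))

count-applyUpTo : ∀ {A : Set} (p : A → Bool) q (f : ℕ → A) h → (∀ {j} → j < h → p (f j) ≡ q) →
                  count p (List.applyUpTo f (suc h)) ≡ h * bit q + bit (p (f h))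
count-applyUpTo p q f zero _ with p (f 0)
... | true  = refl
... | false = refl
count-applyUpTo p q f (suc h) hyp with p (f 0) | hyp {0} (s≤s z≤n) | count-applyUpTo p q (f ∘ suc) h (hyp ∘ s≤s)
... | true  | refl | ih = cong suc ih
... | false | refl | ih = ih

count-core : ∀ (p : ℕ → Bool) q m g → (∀ {j} → j < g + g → p (suc (m + suc j)) ≡ q) →
             count p (core m g) ≡ bit (p (suc (m + 0))) + ((g + g) * bit q + bit (p (suc (m + suc (g + g)))))
count-core p q m g hyp
  rewrite count-map p (λ j → suc (m + j)) (upTo (2 + (g + g)))
  with p (suc (m + 0))
... | true  = cong suc (count-applyUpTo (p ∘ λ j → suc (m + j)) q suc (g + g) hyp)
... | false = count-applyUpTo (p ∘ λ j → suc (m + j)) q suc (g + g) hyp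

-- The share of the two ends of the interval for `a` and, for `m = 0`, of the extra values `0` and
-- `2n − 1`. The remaining `g + g` values of `a` contribute equal terms.
κbase ιbase : ℕ → ℕ → ℕ → ℕ
κbase k zero    d = δ 0 k + 3 * δ 1 k
κbase k (suc m) d = δ d k + δ (suc d) k
ιbase k zero    d = δ 0 k + 3 * δ 1 k
ιbase k (suc m) d = δ d k + δ (suc d) k

stat-step : ∀ x g y → (x + (g + g) * y) + 2 * y ≡ x + (suc g + suc g) * y
stat-step = solve-∀

κstat≡ : ∀ {b} k (v : Vec Bool b) →
         κstat k v ≡ κbase k (row v 0) (#down v) + (gap v + gap v) * δ (suc (#down v)) k
κstat≡ k []          = sym (+-identityʳ _)
κstat≡ k (true  ∷ v) = sym (+-identityʳ _)
κstat≡ k (false ∷ v) rewrite κstat≡ k v | #map {x = false} (down v) =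
  stat-step (κbase k (row v 0) (#down v)) (gap v) (δ (suc (#down v)) k)

ιstat≡ : ∀ {b} k (v : Vec Bool b) →
         ιstat k v ≡ ιbase k (row v 0) (#inner v) + (gap v + gap v) * δ (suc (suc (#inner v))) k
ιstat≡ k []          = sym (+-identityʳ _)
ιstat≡ k (true  ∷ v) = sym (+-identityʳ _)
ιstat≡ k (false ∷ v) rewrite ιstat≡ k v =
  stat-step (ιbase k (row v 0) (#inner v)) (gap v) (δ (suc (suc (#inner v))) k)

row≡0⇒#down≡0 : ∀ {b} (v : Vec Bool b) → row v 0 ≡ 0 → #down v ≡ 0
row≡0⇒#down≡0 []          _  = refl
row≡0⇒#down≡0 (false ∷ v) eq = trans (#map (down v)) (row≡0⇒#down≡0 v eq)

row≡0⇒#inner≡0 : ∀ {b} (v : Vec Bool b) → row v 0 ≡ 0 → #inner v ≡ 0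
row≡0⇒#inner≡0 []          _  = refl
row≡0⇒#inner≡0 (false ∷ v) eq = row≡0⇒#inner≡0 v eq

module _ (m g : ℕ) where

  private b = m + g

  at-core : ∀ j → suc (m + j) + m ≡ m + m + suc j
  at-core j = lemma m j
    where
    lemma : ∀ m j → suc (m + j) + m ≡ m + m + suc j
    lemma = solve-∀

  core-top : 2 + (b + b) ≡ m + m + (2 + (g + g))
  core-top = lemma m g
    where
    lemma : ∀ m g → 2 + ((m + g) + (m + g)) ≡ m + m + (2 + (g + g))
    lemma = solve-∀

  valid-core : ∀ {j} → j ≤ suc (g + g) → Valid b (suc (m + j)) m
  valid-core {j} j≤ = inj₁ (s≤s (m≤m+n m j) ,
    subst₂ _≤_ (sym (at-core j)) (sym core-top) (+-monoʳ-≤ (m + m) (s≤s j≤)))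

  valid-core-up : ∀ {j} → 0 < j → j ≤ g + g → Valid b (suc (m + j)) (suc m)
  valid-core-up {j} 0<j j≤ = inj₁ (s≤s (subst (_≤ m + j) (+-comm m 1) (+-monoʳ-≤ m 0<j)) ,
    subst₂ _≤_ (sym (trans (+-suc (suc (m + j)) m) (trans (cong suc (at-core j)) (sym (+-suc (m + m) (suc j))))))
               (sym core-top) (+-monoʳ-≤ (m + m) (s≤s (s≤s j≤))))

  core-bound : ∀ {j} → suc (m + j) + m ≤ 2 + (b + b) → j ≤ suc (g + g)
  core-bound {j} le = m<1+n⇒m≤n (+-cancelˡ-≤ (m + m) _ _ (subst₂ _≤_ (at-core j) core-top le))

count-∷ : ∀ {A : Set} (p : A → Bool) x xs → count p (x ∷ xs) ≡ bit (p x) + count p xs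
count-∷ p x xs with p x
... | true  = refl
... | false = refl

module _ (k : ℕ) (f : ℕ → ℕ) where

  private
    p : ℕ → Bool
    p a = f a ≡ᵇ k

    at≡ : ∀ {x y} → x ≡ y → δ x k ≡ δ y k
    at≡ = cong (λ x → δ x k)

  count-core≡ : ∀ m g {x q y} → f (suc (m + 0)) ≡ x → (∀ {j} → j < g + g → f (suc (m + suc j)) ≡ q) →
                f (suc (m + suc (g + g))) ≡ y → count p (core m g) ≡ δ x k + ((g + g) * δ q k + δ y k)
  count-core≡ m g {q = q} fx fq fy = trans (count-core p (q ≡ᵇ k) m g (λ j< → cong (_≡ᵇ k) (fq j<)))
    (cong₂ _+_ (at≡ fx) (cong (λ z → (g + g) * δ q k + z) (at≡ fy)))

  count-range-zero : ∀ g {u w x q y} → f 0 ≡ u → f (3 + (g + g)) ≡ w → f 1 ≡ x →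
                     (∀ {j} → j < g + g → f (suc (suc j)) ≡ q) → f (2 + (g + g)) ≡ y →
                     count p (range 0 g) ≡ (δ u k + (δ w k + 0)) + (δ x k + ((g + g) * δ q k + δ y k))
  count-range-zero g fu fw fx fq fy = trans (count-++ p (extra 0 g) (core 0 g))
    (cong₂ _+_ (trans (count-∷ p 0 (3 + (g + g) ∷ [])) (cong₂ _+_ (at≡ fu)
                 (trans (count-∷ p (3 + (g + g)) []) (cong (_+ 0) (at≡ fw)))))
               (count-core≡ 0 g fx fq fy))

-- The first row can shrink except when it is empty or when `m > 0` and `a = m + 1`. For `m = 0` the
-- value `a = 1` can still drop to the admissible `0`.
κ-count : ∀ k m g {b} d → m + g ≡ b → (m ≡ 0 → d ≡ 0) →
          count (λ a → downBit b a m + d ≡ᵇ k) (range m g) ≡ κbase k m d + (g + g) * δ (suc d) k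
κ-count k m g d refl d≡0 = go m refl
  where
  f : ℕ → ℕ
  f a = downBit (m + g) a m + d

  val : ∀ {a x} → bit (does (valid? (m + g) a m)) ≡ x → f (suc a) ≡ x + d
  val {a} eq = cong (_+ d) (trans (length-filter-∷ (λ a → valid? (m + g) a m) a []) (trans (+-identityʳ _) eq))

  one : ∀ {a} → Valid (m + g) a m → f (suc a) ≡ suc d
  one {a} h = val {a} (bit-yes (valid? (m + g) a m) h)

  mid : ∀ {j} → j ≤ g + g → f (suc (m + suc j)) ≡ suc d
  mid {j} j≤ = one (subst (λ a → Valid (m + g) a m) (sym (+-suc m j)) (valid-core m g (m≤n⇒m≤1+n j≤)))

  regroup₀ : ∀ u x g → (u + (x + 0)) + (x + ((g + g) * x + x)) ≡ (u + 3 * x) + (g + g) * x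
  regroup₀ = solve-∀

  regroup : ∀ u x g → u + ((g + g) * x + x) ≡ (u + x) + (g + g) * x
  regroup = solve-∀

  go : ∀ m′ → m′ ≡ m → count (λ a → f a ≡ᵇ k) (range m′ g) ≡ κbase k m′ d + (g + g) * δ (suc d) k
  go zero refl =
    trans (count-range-zero k f g refl (mid′ ≤-refl) (one (inj₂ (refl , inj₁ refl))) (mid ∘ <⇒≤) (mid ≤-refl))
      (trans (regroup₀ (δ d k) (δ (suc d) k) g)
        (cong (λ z → (δ z k + 3 * δ (suc z) k) + (g + g) * δ (suc d) k) (d≡0 refl)))
    where
    mid′ : ∀ {j} → j ≤ suc (g + g) → f (suc (suc j)) ≡ suc d
    mid′ j≤ = one (valid-core 0 g j≤)
  go (suc m′) refl =
    trans (count-core≡ k f m g low (mid ∘ <⇒≤) (mid ≤-refl)) (regroup (δ d k) (δ (suc d) k) g)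
    where
    low : f (suc (m + 0)) ≡ d
    low = val {m + 0} (bit-no (valid? (m + g) (m + 0) m)
      λ { (inj₁ (lt , _)) → <-irrefl (sym (+-identityʳ m)) lt ; (inj₂ (() , _)) })

-- In the interior both of the two longest rows can grow. At `a = m + 1` the second would catch up
-- with the first; at the upper end both are blocked by the bound on `a + m`, except that for
-- `m = 0` the first may still reach `2n − 1`. Here `o` is `movable v`, which equals 1 whenever the
-- interior is nonempty.
ι-count : ∀ k m g {b} d o → m + g ≡ b → (m ≡ 0 → d ≡ 0) → (0 < g → o ≡ 1) →
          count (λ a → bit (does (valid? b (suc a) m)) + (o * bit (does (valid? b a (suc m))) + d) ≡ᵇ k) (range m g)
          ≡ ιbase k m d + (g + g) * δ (suc (suc d)) k
ι-count k m g d o refl d≡0 o≡1 = go m refl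
  where
  f : ℕ → ℕ
  f a = bit (does (valid? (m + g) (suc a) m)) + (o * bit (does (valid? (m + g) a (suc m))) + d)

  val : ∀ a {x y} → bit (does (valid? (m + g) (suc a) m)) ≡ x → bit (does (valid? (m + g) a (suc m))) ≡ y →
        f a ≡ x + (o * y + d)
  val a = cong₂ (λ x y → x + (o * y + d))

  yes₁ : ∀ a → Valid (m + g) (suc a) m → bit (does (valid? (m + g) (suc a) m)) ≡ 1
  yes₁ a = bit-yes (valid? (m + g) (suc a) m)
  no₁ : ∀ a → ¬ Valid (m + g) (suc a) m → bit (does (valid? (m + g) (suc a) m)) ≡ 0
  no₁ a = bit-no (valid? (m + g) (suc a) m)
  yes₂ : ∀ a → Valid (m + g) a (suc m) → bit (does (valid? (m + g) a (suc m))) ≡ 1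
  yes₂ a = bit-yes (valid? (m + g) a (suc m))
  no₂ : ∀ a → ¬ Valid (m + g) a (suc m) → bit (does (valid? (m + g) a (suc m))) ≡ 0
  no₂ a = bit-no (valid? (m + g) a (suc m))

  *0 : ∀ x → x + (o * 0 + d) ≡ x + d
  *0 x = cong (λ z → x + (z + d)) (*-zeroʳ o)

  low : f (suc (m + 0)) ≡ suc d
  low = trans (val (suc (m + 0)) (yes₁ (suc (m + 0)) (subst (λ a → Valid (m + g) a m) (cong suc (+-suc m 0)) (valid-core m g (s≤s z≤n))))
                   (no₂ (suc (m + 0)) λ { (inj₁ (lt , _)) → <-irrefl (cong suc (sym (+-identityʳ m))) lt ; (inj₂ (() , _)) }))
              (*0 1)

  positive : ∀ g {j} → j < g + g → 0 < g
  positive (suc _) _ = s≤s z≤n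

  mid : ∀ {j} → j < g + g → f (suc (m + suc j)) ≡ suc (suc d)
  mid {j} j< = trans
    (val (suc (m + suc j)) (yes₁ (suc (m + suc j)) (subst (λ a → Valid (m + g) a m) (cong suc (+-suc m (suc j))) (valid-core m g (s≤s j<))))
                           (yes₂ (suc (m + suc j)) (valid-core-up m g (s≤s z≤n) j<)))
    (cong (λ o → 1 + (o * 1 + d)) (o≡1 (positive g j<)))

  last₂ : ¬ Valid (m + g) (suc (m + suc (g + g))) (suc m)
  last₂ (inj₁ (_ , le)) = <-irrefl refl (core-bound m g
    (subst (_≤ 2 + ((m + g) + (m + g))) (trans (+-suc _ m) (cong (λ z → suc z + m) (sym (+-suc m (suc (g + g)))))) le))
  last₂ (inj₂ (() , _))

  regroup₀ : ∀ u x y g → (x + (u + 0)) + (x + ((g + g) * y + x)) ≡ (u + 3 * x) + (g + g) * y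
  regroup₀ = solve-∀

  regroup : ∀ u x y g → x + ((g + g) * y + u) ≡ (u + x) + (g + g) * y
  regroup = solve-∀

  go : ∀ m′ → m′ ≡ m → count (λ a → f a ≡ᵇ k) (range m′ g) ≡ ιbase k m′ d + (g + g) * δ (suc (suc d)) k
  go zero refl = trans (count-range-zero k f g {1} {0} {1} {2} {1} bottom top (trans low (cong suc (d≡0 refl)))
      (λ j< → trans (mid j<) (cong (suc ∘ suc) (d≡0 refl))) last)
    (trans (regroup₀ (δ 0 k) (δ 1 k) (δ 2 k) g)
      (cong (λ d → (δ 0 k + 3 * δ 1 k) + (g + g) * δ (suc (suc d)) k) (sym (d≡0 refl))))
    where
    +d : ∀ x → x + d ≡ x
    +d x = trans (cong (λ z → x + z) (d≡0 refl)) (+-identityʳ x)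

    bottom : f 0 ≡ 1
    bottom = trans (val 0 (yes₁ 0 (valid-core 0 g {0} z≤n)) (no₂ 0 λ { (inj₁ (() , _)) ; (inj₂ (() , _)) }))
                   (trans (*0 1) (+d 1))

    top : f (3 + (g + g)) ≡ 0
    top = trans (val (3 + (g + g))
        (no₁ (3 + (g + g)) λ { (inj₁ (_ , le)) → <-irrefl refl (≤-trans (n≤1+n _) (core-bound 0 g {3 + (g + g)} le))
               ; (inj₂ (_ , inj₁ ())) ; (inj₂ (_ , inj₂ eq)) → <-irrefl (sym eq) ≤-refl })
        (no₂ (3 + (g + g)) λ { (inj₁ (_ , le)) → <-irrefl refl (≤-trans (m≤m+n (3 + (g + g)) 1) le) ; (inj₂ (() , _)) }))
      (trans (*0 0) (+d 0))

    last : f (2 + (g + g)) ≡ 1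
    last = trans (val (2 + (g + g)) (yes₁ (2 + (g + g)) (inj₂ (refl , inj₂ refl))) (no₂ (2 + (g + g)) last₂)) (trans (*0 1) (+d 1))
  go (suc m′) refl = trans (count-core≡ k f m g low mid last) (regroup (δ d k) (δ (suc d) k) (δ (suc (suc d)) k) g)
    where
    last : f (suc (m + suc (g + g))) ≡ d
    last = trans (val (suc (m + suc (g + g)))
        (no₁ (suc (m + suc (g + g))) λ { (inj₁ (_ , le)) → <-irrefl refl (core-bound m g
                   (subst (λ z → suc z + m ≤ 2 + ((m + g) + (m + g))) (sym (+-suc m (suc (g + g)))) le))
               ; (inj₂ (() , _)) })
        (no₂ (suc (m + suc (g + g))) last₂))
      (*0 0)

movable-gap : ∀ {b} (v : Vec Bool b) → 0 < gap v → movable v ≡ 1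
movable-gap (false ∷ v) _ = refl

κ-codes : ∀ b k → count (λ x → length (downCode x) ≡ᵇ k) (codes b) ≡ (3 + b) C dbl k
κ-codes b k = trans (count-allSubsets _ b _) (trans (Σᵛ-cong b perRow) (κstat-closed b k))
  where
  perRow : ∀ v → count (λ x → length (downCode x) ≡ᵇ k) (map (_, v) (range (row v 0) (gap v))) ≡ κstat k v
  perRow v = trans (count-map _ (_, v) (range (row v 0) (gap v)))
    (trans (count-cong (range (row v 0) (gap v)) λ a∈ →
              cong (_≡ᵇ k) (#downCode {x = _ , v} (to (∈-range (row v 0) (gap v) (row+gap v)) a∈)))
      (trans (κ-count k (row v 0) (gap v) (#down v) (row+gap v) (row≡0⇒#down≡0 v)) (sym (κstat≡ k v))))

ι-codes : ∀ b k → count (λ x → length (upCode x) ≡ᵇ k) (codes b) ≡ ιclosed b k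
ι-codes b k = trans (count-allSubsets _ b _) (trans (Σᵛ-cong b perRow) (ιstat-closed b k))
  where
  perRow : ∀ v → count (λ x → length (upCode x) ≡ᵇ k) (map (_, v) (range (row v 0) (gap v))) ≡ ιstat k v
  perRow v = trans (count-map _ (_, v) (range (row v 0) (gap v)))
    (trans (count-cong (range (row v 0) (gap v)) λ a∈ →
              cong (_≡ᵇ k) (#upCode {x = _ , v} (to (∈-range (row v 0) (gap v) (row+gap v)) a∈)))
      (trans (ι-count k (row v 0) (gap v) (#inner v) (movable v) (row+gap v) (row≡0⇒#inner≡0 v) (movable-gap v))
             (sym (ιstat≡ k v))))

-- The poset of codes

rowCode : ∀ {b} → Code b → ℕ → ℕ
rowCode (a , v) zero    = a
rowCode (a , v) (suc i) = row v i

_⊑_ : ∀ {b} → Code b → Code b → Set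
x ⊑ y = ∀ i → rowCode x i ≤ rowCode y i

⊑-antisym : ∀ {b} {x y : Code b} → x ⊑ y → y ⊑ x → x ≡ y
⊑-antisym x⊑y y⊑x = cong₂ _,_ (≤-antisym (x⊑y 0) (y⊑x 0))
  (row-injective _ _ λ i → ≤-antisym (x⊑y (suc i)) (y⊑x (suc i)))

valid-bound : ∀ {b a m} → Valid b (suc a) m → a + m ≤ 2 + (b + b)
valid-bound (inj₁ (_ , le)) = ≤-trans (n≤1+n _) le
valid-bound {b} (inj₂ (refl , inj₂ refl)) = ≤-reflexive (+-identityʳ _)

-- The two bounds come from different ideals: the smaller one keeps `a` above `m`, the larger one
-- keeps `a + m` within its limit.
valid-pred : ∀ {b a′ a m} → Valid b a′ m → Valid b (suc a) m → a′ ≤ a → Valid b a m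
valid-pred {b} (inj₁ (m<a′ , _)) h a′≤a = inj₁ (≤-trans m<a′ a′≤a , valid-bound {b} h)
valid-pred {b} {a = zero}  (inj₂ (refl , _)) h _ = inj₂ (refl , inj₁ refl)
valid-pred {b} {a = suc a} (inj₂ (refl , _)) h _ = inj₁ (s≤s z≤n , valid-bound {b} h)

∈-downCode : ∀ {b} a c (v w : Vec Bool b) → (c , w) ∈ downCode (a , v) ⇔
             (Ok (c , w) × ((a ≡ suc c × w ≡ v) ⊎ (a ≡ c × w ∈ down v)))
∈-downCode {b} a c v w = mk⇔ ⇒ ⇐
  where
  candidates : List (Code b)
  candidates = map (_, v) (preds a) ++ map (a ,_) (down v)

  ∈-preds : ∀ {c} a → c ∈ preds a → a ≡ suc c
  ∈-preds (suc a) (here refl) = refl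

  ⇒ : (c , w) ∈ downCode (a , v) → Ok (c , w) × ((a ≡ suc c × w ≡ v) ⊎ (a ≡ c × w ∈ down v))
  ⇒ h with ∈-filter⁻ ok? {xs = candidates} h
  ... | h₁ , ok with ∈-++⁻ (map (_, v) (preds a)) h₁
  ...   | inj₁ h₂ with ∈-map⁻ (_, v) h₂
  ...     | _ , c∈ , refl = ok , inj₁ (∈-preds a c∈ , refl)
  ⇒ h | h₁ , ok | inj₂ h₂ with ∈-map⁻ (a ,_) h₂
  ... | _ , w∈ , refl = ok , inj₂ (refl , w∈)

  ⇐ : Ok (c , w) × ((a ≡ suc c × w ≡ v) ⊎ (a ≡ c × w ∈ down v)) → (c , w) ∈ downCode (a , v)
  ⇐ (ok , inj₁ (refl , refl)) = ∈-filter⁺ ok? (here refl) ok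
  ⇐ (ok , inj₂ (refl , w∈))   = ∈-filter⁺ ok? (∈-++⁺ʳ (map (_, v) (preds a)) (∈-map⁺ (a ,_) w∈)) ok

∈-upCode : ∀ {b} a c (v w : Vec Bool b) → (a , v) ∈ upCode (c , w) ⇔
           (Ok (a , v) × ((a ≡ suc c × w ≡ v) ⊎ (a ≡ c × v ∈ up w)))
∈-upCode {b} a c v w = mk⇔ ⇒ ⇐
  where
  ⇒ : (a , v) ∈ upCode (c , w) → Ok (a , v) × ((a ≡ suc c × w ≡ v) ⊎ (a ≡ c × v ∈ up w))
  ⇒ h with ∈-filter⁻ ok? {xs = (suc c , w) ∷ map (c ,_) (up w)} h
  ... | here refl , ok = ok , inj₁ (refl , refl)
  ... | there h₁ , ok with ∈-map⁻ (c ,_) h₁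
  ...   | _ , v∈ , refl = ok , inj₂ (refl , v∈)

  ⇐ : Ok (a , v) × ((a ≡ suc c × w ≡ v) ⊎ (a ≡ c × v ∈ up w)) → (a , v) ∈ upCode (c , w)
  ⇐ (ok , inj₁ (refl , refl)) = ∈-filter⁺ ok? {xs = (suc c , w) ∷ map (c ,_) (up w)} (here refl) ok
  ⇐ (ok , inj₂ (refl , v∈))   = ∈-filter⁺ ok? {xs = (suc c , w) ∷ map (c ,_) (up w)} (there (∈-map⁺ (c ,_) v∈)) ok

∈-downCode⇔∈-upCode : ∀ {b} {x y : Code b} → Ok x → Ok y → y ∈ downCode x ⇔ x ∈ upCode y
∈-downCode⇔∈-upCode {x = a , v} {c , w} okx oky = mk⇔
  (λ h → from (∈-upCode a c v w) (okx , [ inj₁ , (λ (eq , w∈) → inj₂ (eq , to (∈-down⇔∈-up v w) w∈)) ]′ (proj₂ (to (∈-downCode a c v w) h))))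
  (λ h → from (∈-downCode a c v w) (oky , [ inj₁ , (λ (eq , v∈) → inj₂ (eq , from (∈-down⇔∈-up v w) v∈)) ]′ (proj₂ (to (∈-upCode a c v w) h))))

unique-downCode : ∀ {b} (x : Code b) → Unique (downCode x)
unique-downCode (a , v) = Unique.filter⁺ ok? (Unique.++⁺ (Unique.map⁺ (cong proj₁) (unique-preds a))
  (Unique.map⁺ (cong proj₂) (unique-down v)) (disjoint a))
  where
  unique-preds : ∀ a → Unique (preds a)
  unique-preds zero    = []
  unique-preds (suc a) = [] ∷ []

  disjoint : ∀ a {y} → ¬ (y ∈ map (_, v) (preds a) × y ∈ map (a ,_) (down v))
  disjoint (suc a) (here refl , h) with ∈-map⁻ (suc a ,_) h
  ... | _ , _ , ()

unique-upCode : ∀ {b} (x : Code b) → Unique (upCode x)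
unique-upCode (a , v) = Unique.filter⁺ ok? {xs = (suc a , v) ∷ map (a ,_) (up v)} (All.tabulate fresh ∷ Unique.map⁺ (cong proj₂) (unique-up v))
  where
  fresh : ∀ {y} → y ∈ map (a ,_) (up v) → ¬ (suc a , v) ≡ y
  fresh h refl with ∈-map⁻ (a ,_) h
  ... | _ , _ , ()

downCode-row : ∀ {b} {x y : Code b} → y ∈ downCode x → Pred≡At (rowCode x) (rowCode y)
downCode-row {x = a , v} {c , w} h with proj₂ (to (∈-downCode a c v w) h)
... | inj₁ (refl , refl) = 0 , refl , λ { zero j≢ → ⊥-elim (j≢ refl) ; (suc j) _ → refl }
... | inj₂ (refl , w∈) with down-row v w∈
...   | i , eq , rest = suc i , eq , λ { zero _ → refl ; (suc j) j≢ → rest j (j≢ ∘ cong suc) }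

-- Lower rows are treated first because shrinking them never destroys validity. When they agree, `y`
-- has the same second row as `x`, so its validity bounds the shortened first row from below.
≡-or-belowCode : ∀ {b} {y x : Code b} → Ok y → Ok x → y ⊑ x → y ≡ x ⊎ (∃[ z ] z ∈ downCode x × y ⊑ z)
≡-or-belowCode {b} {c , w} {a , v} oky okx y⊑x with ≡-or-below w v (y⊑x ∘ suc)
... | inj₂ (z , z∈ , w≼z) = inj₂ ((a , z) ,
        from (∈-downCode a a v z) (valid-mono {b} {a} (Pred≡At⇒≤ (down-row v z∈) 0) okx , inj₂ (refl , z∈)) ,
        λ { zero → y⊑x 0 ; (suc i) → w≼z i })
... | inj₁ refl with m≤n⇒m<n∨m≡n (y⊑x 0)
...   | inj₂ refl = inj₁ refl
...   | inj₁ (s≤s {n = a′} c≤a′) = inj₂ ((a′ , v) ,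
        from (∈-downCode a a′ v v) (valid-pred {b} {c} oky okx c≤a′ , inj₁ (refl , refl)) ,
        λ { zero → c≤a′ ; (suc i) → ≤-refl })

rowCode-strict : ∀ {b} (x : Code b) → Ok x → ∀ i → rowCode x (suc i) ≤ pred (rowCode x i)
rowCode-strict (a , v) (inj₁ (m<a , _)) zero = suc[m]≤n⇒m≤pred[n] m<a
rowCode-strict (a , v) (inj₂ (m≡0 , _)) zero = ≤-trans (≤-reflexive m≡0) z≤n
rowCode-strict (a , v) ok (suc i) = row-strict v i

-- The inequality says `i < c′` for the last box `(i, i + rowCode x i)` of row `i`, that is, the row
-- stays inside the diagram.
rowCode-bound : ∀ {b} (x : Code b) → Ok x → ∀ i → 0 < rowCode x i → i + (i + rowCode x i) < (2 + b) + (2 + b)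
rowCode-bound {b} (a , v) ok zero 0<a = subst (a <_) (sym (4+ b)) (s≤s (a≤ ok))
  where
  4+ : ∀ b → (2 + b) + (2 + b) ≡ 4 + (b + b)
  4+ = solve-∀
  a≤ : Valid b a (row v 0) → a ≤ 3 + (b + b)
  a≤ (inj₁ (_ , le))        = ≤-trans (m≤m+n a _) (≤-trans le (n≤1+n _))
  a≤ (inj₂ (_ , inj₁ refl)) = z≤n
  a≤ (inj₂ (_ , inj₂ refl)) = ≤-refl
rowCode-bound {b} (a , v) ok (suc i) 0<r = +-mono-≤-< (s≤s i≤b+1) (s≤s i+r<)
  where
  i≤b : i ≤ b
  i≤b = <⇒≤ (m<n∸m′ (≤-trans 0<r (row≤ v i)))
    where
    m<n∸m′ : 0 < b ∸ i → i < b
    m<n∸m′ h = m∸n≢0⇒n<m (>⇒≢ h)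
  i≤b+1 : i ≤ suc b
  i≤b+1 = m≤n⇒m≤1+n i≤b
  i+r< : i + row v i < suc b
  i+r< = s≤s (≤-trans (+-monoʳ-≤ i (row≤ v i)) (≤-reflexive (m+[n∸m]≡n i≤b)))

-- Nonempty rows shrink by at least one per step down, so their right ends `i + rowCode x i` never
-- move to the right: a box in the shape has every box above it in the shape.
rowCode-columns : ∀ {b} (x : Code b) → Ok x → ∀ {i c} j → i < c → c ≤ i + rowCode x i → j ≤ i → c ≤ j + rowCode x j
rowCode-columns x ok {zero}  zero _ h _ = h
rowCode-columns x ok {suc i} j i<c h j≤ with m≤n⇒m<n∨m≡n j≤
... | inj₂ refl     = h
... | inj₁ (s≤s j≤i) = rowCode-columns x ok {i} j (<-trans (n<1+n i) i<c) (step≤ (rowCode x i) positive (rowCode-strict x ok i)) j≤i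
  where
  positive : 0 < rowCode x (suc i)
  positive = +-cancelˡ-< (suc i) 0 _ (subst (_< suc i + rowCode x (suc i)) (sym (+-identityʳ (suc i))) (<-≤-trans i<c h))
  step≤ : ∀ r → 0 < rowCode x (suc i) → rowCode x (suc i) ≤ pred r → _ ≤ i + r
  step≤ zero    p q = ⊥-elim (<-irrefl refl (≤-trans p q))
  step≤ (suc r) p q = ≤-trans h (≤-trans (s≤s (+-monoʳ-≤ i q)) (≤-reflexive (sym (+-suc i r))))

-- The embedding of codes into subsets of the roots

T-⊆ᵇ : ∀ {m} (u v : Vec Bool m) → T (u ⊆ᵇ v) ⇔ (∀ t → T (lookup u t) → T (lookup v t))
T-⊆ᵇ []      []      = mk⇔ (λ _ ()) (λ _ → tt)
T-⊆ᵇ (a ∷ u) (b ∷ v) = mk⇔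
  (λ h → let (a⇒b , u⊆v) = to T-∧ h in λ { Fin.zero → to T-⇒ a⇒b ; (Fin.suc t) → to (T-⊆ᵇ u v) u⊆v t })
  (λ f → from T-∧ (from T-⇒ (f Fin.zero) , from (T-⊆ᵇ u v) (f ∘ Fin.suc)))

lookup-ext : ∀ {m} {u v : Vec Bool m} → (∀ t → T (lookup u t) ⇔ T (lookup v t)) → u ≡ v
lookup-ext {u = []}    {[]}    _ = refl
lookup-ext {u = a ∷ u} {b ∷ v} h = cong₂ _∷_ (T-cong (h Fin.zero)) (lookup-ext (h ∘ Fin.suc))

-- n is kept apart from 2 + b so that the list of roots does not start to unfold.
module Encoding (n b : ℕ) (n≡2+b : n ≡ 2 + b) where

  iₜ cₜ : Fin (N n) → ℕ
  iₜ t = Box.i (boxAt {n} t)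
  cₜ t = Box.c (boxAt {n} t)

  opaque
    enc : Code b → Sub n
    enc x = tabulate (λ t → cₜ t ≤ᵇ iₜ t + rowCode x (iₜ t))

    T-enc : ∀ x t → T (lookup (enc x) t) ⇔ (cₜ t ≤ iₜ t + rowCode x (iₜ t))
    T-enc x t rewrite Vec.lookup∘tabulate (λ t → cₜ t ≤ᵇ iₜ t + rowCode x (iₜ t)) t =
      mk⇔ (≤ᵇ⇒≤ _ _) ≤⇒≤ᵇ

  endBox : ∀ x → Ok x → ∀ i → 0 < rowCode x i → Box n
  endBox x ok i 0<r = box i (i + rowCode x i) (n + n ∸ (i + rowCode x i)) (m<m+n i 0<r)
    (m+n≤o⇒m≤o∸n (suc i) i+c<2n) (m+[n∸m]≡n (≤-trans (m≤n+m _ (suc i)) i+c<2n))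
    where
    i+c<2n : suc i + (i + rowCode x i) ≤ n + n
    i+c<2n = subst (λ n → i + (i + rowCode x i) < n + n) (sym n≡2+b) (rowCode-bound x ok i 0<r)

  -- A nonempty row of `x` fits into that of `y` as soon as its last box does; `endBox` supplies
  -- this box.
  enc-⊆ : ∀ {x} y → Ok x → T (enc x ⊆ᵇ enc y) ⇔ x ⊑ y
  enc-⊆ {x} y ok = mk⇔ ⇒ ⇐
    where
    ⇐ : x ⊑ y → T (enc x ⊆ᵇ enc y)
    ⇐ x⊑y = from (T-⊆ᵇ (enc x) (enc y)) λ t h →
      from (T-enc y t) (≤-trans (to (T-enc x t) h) (+-monoʳ-≤ (iₜ t) (x⊑y (iₜ t))))

    ⇒ : T (enc x ⊆ᵇ enc y) → x ⊑ y
    ⇒ h i with rowCode x i in eq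
    ... | zero  = z≤n
    ... | suc r = +-cancelˡ-≤ i _ _ (subst (_≤ i + rowCode y i) (trans cβ (cong (λ z → i + z) eq)) inY)
      where
      β = endBox x ok i (subst (0 <_) (sym eq) (s≤s z≤n))
      t = indexOf β
      iβ : iₜ t ≡ i
      iβ = proj₁ (boxAt-indexOf {n} β)
      cβ : cₜ t ≡ i + rowCode x i
      cβ = proj₂ (boxAt-indexOf {n} β)
      inX : cₜ t ≤ iₜ t + rowCode x (iₜ t)
      inX = ≤-reflexive (trans cβ (cong (λ i → i + rowCode x i) (sym iβ)))
      inY : cₜ t ≤ i + rowCode y i
      inY = subst (λ j → cₜ t ≤ j + rowCode y j) iβ (to (T-enc y t) (to (T-⊆ᵇ (enc x) (enc y)) h t (from (T-enc x t) inX)))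

  enc-injective : ∀ {x y} → Ok x → Ok y → enc x ≡ enc y → x ≡ y
  enc-injective {x} {y} okx oky eq = ⊑-antisym
    (to (enc-⊆ y okx) (from (T-⊆ᵇ (enc x) (enc y)) λ t → subst (λ u → T (lookup u t)) eq))
    (to (enc-⊆ x oky) (from (T-⊆ᵇ (enc y) (enc x)) λ t → subst (λ u → T (lookup u t)) (sym eq)))

  module Poset (∈-Ab : ∀ {I} → I ∈ Ab n ⇔ (∃[ x ] Ok x × I ≡ enc x)) where

    unique-Ab : Unique (Ab n)
    unique-Ab = unique-filterᵇ _ (unique-allSubsets (N n))

    count-Ab : ∀ p → count p (Ab n) ≡ count (p ∘ enc) (codes b)
    count-Ab = count-transport (λ x∈ y∈ → enc-injective (to ∈-codes x∈) (to ∈-codes y∈)) (unique-codes b) unique-Ab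
      (mk⇔ (λ h → let (x , ok , eq) = to ∈-Ab h in x , from ∈-codes ok , eq)
           (λ (x , x∈ , eq) → from ∈-Ab (x , to ∈-codes x∈ , eq)))

    T-⊂ᵇ : ∀ {x y} → Ok x → Ok y → T (enc x ⊂ᵇ enc y) ⇔ (x ⊑ y × ¬ y ⊑ x)
    T-⊂ᵇ {x} {y} okx oky = mk⇔
      (λ h → let (p , q) = to T-∧ h in to (enc-⊆ y okx) p , to T-not q ∘ from (enc-⊆ x oky))
      (λ (p , q) → from T-∧ (from (enc-⊆ y okx) p , from T-not (q ∘ to (enc-⊆ x oky))))

    -- If `x` covers `y`, some one-box removal `z` of `x` still contains `y`, and having nothing
    -- strictly between forces `z = y`. Conversely, a difference of one box leaves no room for a
    -- third ideal.
    T-coversAb : ∀ {x y} → Ok x → Ok y → T (coversAb n (enc x) (enc y)) ⇔ y ∈ downCode x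
    T-coversAb {x} {y} okx oky = mk⇔ ⇒ ⇐
      where
      between : Sub n → Bool
      between z = (enc y ⊂ᵇ z) ∧ (z ⊂ᵇ enc x)

      Ok-down : ∀ {z} → z ∈ downCode x → Ok z
      Ok-down {z} z∈ = proj₁ (to (∈-downCode (proj₁ x) (proj₁ z) (proj₂ x) (proj₂ z)) z∈)

      proper : ∀ {z} → z ∈ downCode x → ¬ x ⊑ z
      proper {z} z∈ x⊑z = let (i , eq , _) = downCode-row {x = x} {z} z∈ in
        <-irrefl refl (≤-trans (≤-reflexive (sym eq)) (x⊑z i))

      ⇒ : T (coversAb n (enc x) (enc y)) → y ∈ downCode x
      ⇒ h = pick (≡-or-belowCode oky okx y⊑x)
        where
        strict = to (T-⊂ᵇ oky okx) (proj₁ (to T-∧ h))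
        y⊑x = proj₁ strict
        none : ¬ T (any between (Ab n))
        none = to T-not (proj₂ (to (T-∧ {enc y ⊂ᵇ enc x}) h))
        pick : y ≡ x ⊎ (∃[ z ] z ∈ downCode x × y ⊑ z) → y ∈ downCode x
        pick (inj₁ refl) = ⊥-elim (proj₂ strict y⊑x)
        pick (inj₂ (z , z∈ , y⊑z)) with all? z⊑y
          where
          z⊑y : Dec (T (enc z ⊆ᵇ enc y))
          z⊑y = T? _
          -- The relation `z ⊑ y` ranges over infinitely many rows; it is decided through the
          -- Boolean inclusion of the encodings.
          all? : Dec (T (enc z ⊆ᵇ enc y)) → Dec (z ⊑ y)
          all? (yes p) = yes (to (enc-⊆ y (Ok-down z∈)) p)
          all? (no  p) = no (p ∘ from (enc-⊆ y (Ok-down z∈)))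
        ... | yes z⊑y = subst (_∈ downCode x) (⊑-antisym z⊑y y⊑z) z∈
        ... | no  z⋢y = ⊥-elim (none (from (T-any between (Ab n)) (enc z , from ∈-Ab (z , Ok-down z∈ , refl) ,
                from T-∧ (from (T-⊂ᵇ oky (Ok-down z∈)) (y⊑z , z⋢y) ,
                          from (T-⊂ᵇ (Ok-down z∈) okx) (Pred≡At⇒≤ (downCode-row {x = x} {z} z∈) , proper z∈)))))

      ⇐ : y ∈ downCode x → T (coversAb n (enc x) (enc y))
      ⇐ y∈ = from T-∧ (from (T-⊂ᵇ oky okx) (Pred≡At⇒≤ one , proper y∈) , from T-not none)
        where
        one : Pred≡At (rowCode x) (rowCode y)
        one = downCode-row {x = x} {y} y∈

        -- In the only row where `x` and `y` differ, they differ by one, so `z` agrees there with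
        -- one of them; in all other rows the three coincide.
        squeeze : ∀ {z} → y ⊑ z → z ⊑ x → x ⊑ z ⊎ z ⊑ y
        squeeze {z} y⊑z z⊑x with one
        ... | i₀ , eq , rest with m≤n⇒m<n∨m≡n (z⊑x i₀)
        ...   | inj₁ z<x = inj₂ λ i → at₂ i (i ≟ i₀)
          where
          at₂ : ∀ i → Dec (i ≡ i₀) → rowCode z i ≤ rowCode y i
          at₂ i (yes refl) = m<1+n⇒m≤n (≤-trans z<x (≤-reflexive eq))
          at₂ i (no  i≢)   = ≤-trans (z⊑x i) (≤-reflexive (rest i i≢))
        ...   | inj₂ z≡x = inj₁ λ i → at₁ i (i ≟ i₀)
          where
          at₁ : ∀ i → Dec (i ≡ i₀) → rowCode x i ≤ rowCode z i
          at₁ i (yes refl) = ≤-reflexive (sym z≡x)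
          at₁ i (no  i≢)   = ≤-trans (≤-reflexive (rest i i≢)) (y⊑z i)

        none : ¬ T (any between (Ab n))
        none h with to (T-any between (Ab n)) h
        ... | I , I∈ , between-I with to ∈-Ab I∈
        ...   | z , okz , refl with to (T-∧ {enc y ⊂ᵇ enc z}) between-I
        ...     | y⊂z , z⊂x with to (T-⊂ᵇ oky okz) y⊂z | to (T-⊂ᵇ okz okx) z⊂x
        ...       | y⊑z , z⋢y | z⊑x , x⋢z = [ x⋢z , z⋢y ]′ (squeeze y⊑z z⊑x)

    κ-enc : ∀ {x} → Ok x → κ n (enc x) ≡ length (downCode x)
    κ-enc {x} ok = trans (count-Ab (coversAb n (enc x)))
      (length-unique (unique-filterᵇ p (unique-codes b)) (unique-downCode x) λ {y} → mk⇔
        (λ h → let (y∈ , c) = to (∈-filterᵇ p (codes b)) h in to (T-coversAb ok (to ∈-codes y∈)) c)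
        (λ y∈ → let oky = proj₁ (to (∈-downCode (proj₁ x) (proj₁ y) (proj₂ x) (proj₂ y)) y∈) in
          from (∈-filterᵇ p (codes b)) (from ∈-codes oky , from (T-coversAb ok oky) y∈)))
      where
      p : Code b → Bool
      p y = coversAb n (enc x) (enc y)

    ι-enc : ∀ {x} → Ok x → ι n (enc x) ≡ length (upCode x)
    ι-enc {x} ok = trans (count-Ab (λ I → coversAb n I (enc x)))
      (length-unique (unique-filterᵇ p (unique-codes b)) (unique-upCode x) λ {y} → mk⇔
        (λ h → let (y∈ , c) = to (∈-filterᵇ p (codes b)) h in
          to (∈-downCode⇔∈-upCode (to ∈-codes y∈) ok) (to (T-coversAb (to ∈-codes y∈) ok) c))
        (λ y∈ → let oky = proj₁ (to (∈-upCode (proj₁ y) (proj₁ x) (proj₂ y) (proj₂ x)) y∈) in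
          from (∈-filterᵇ p (codes b)) (from ∈-codes oky ,
            from (T-coversAb oky ok) (from (∈-downCode⇔∈-upCode oky ok) y∈))))
      where
      p : Code b → Bool
      p y = coversAb n (enc y) (enc x)

    Ku-closed : ∀ k → Ku n k ≡ (3 + b) C dbl k
    Ku-closed k = trans (count-Ab (λ I → κ n I ≡ᵇ k))
      (trans (count-cong (codes b) (λ x∈ → cong (_≡ᵇ k) (κ-enc (to ∈-codes x∈)))) (κ-codes b k))

    Kl-closed : ∀ k → Kl n k ≡ ιclosed b k
    Kl-closed k = trans (count-Ab (λ I → ι n I ≡ᵇ k))
      (trans (count-cong (codes b) (λ x∈ → cong (_≡ᵇ k) (ι-enc (to ∈-codes x∈)))) (ι-codes b k))

-- Abelian ideals and codes

-- g i d says whether the d-th box of row i is present (d ≥ 1; the value at d = 0 is irrelevant).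
record Closed (g : ℕ → ℕ → Bool) : Set where
  field
    left : ∀ {i d} → 0 < d → T (g i (suc d)) → T (g i d)
    diag : ∀ {i d} → 0 < d → T (g (suc i) d) → T (g i (suc d))

  reach : ∀ {i e d} → 0 < e → e ≤ d → T (g i d) → T (g i e)
  reach {d = d} 0<e e≤d h with m≤n⇒m<n∨m≡n e≤d
  ... | inj₂ refl                     = h
  ... | inj₁ (s≤s {n = d′} e≤d′) = reach 0<e e≤d′ (left (<-≤-trans 0<e e≤d′) h)

  first : ∀ i {d} → 0 < d → T (g i d) → T (g 0 1)
  first zero    0<d h = reach (s≤s z≤n) 0<d h
  first (suc i) 0<d h = first i (s≤s z≤n) (diag 0<d h)

tailClosed : ∀ {g} → Closed g → Closed (g ∘ suc)
tailClosed cl = record { left = Closed.left cl ; diag = Closed.diag cl }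

-- Tries lengths from the largest down. A row that reaches length `suc b` sets that bit and is used
-- up; the next row then competes for the shorter lengths only.
build : ∀ b → (ℕ → ℕ → Bool) → Vec Bool b
build zero    g = []
build (suc b) g = if g 0 (suc b) then true ∷ build b (g ∘ suc) else false ∷ build b g

build-row : ∀ b {g} → Closed g → ¬ T (g 0 (suc b)) → ∀ i {d} → 0 < d → T (g i d) ⇔ d ≤ row (build b g) i
build-row zero    {g} cl top i 0<d = mk⇔ (λ h → ⊥-elim (top (Closed.first cl i 0<d h)))
                                         (λ d≤0 → ⊥-elim (<-irrefl refl (≤-trans 0<d d≤0)))
build-row (suc b) {g} cl top i {d} 0<d with g 0 (suc b) in eq
... | false = build-row b cl (subst T eq) i 0<d
... | true  = at-row i
  where
  at-row : ∀ i → T (g i d) ⇔ d ≤ row (true ∷ build b (g ∘ suc)) i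
  at-row zero    = mk⇔ (λ h → ≮⇒≥ λ sb<d → top (Closed.reach cl (s≤s z≤n) sb<d h))
                       (λ d≤ → Closed.reach cl 0<d d≤ (≡⇒T eq))
  -- Diagonal closure passes the emptiness hypothesis on: a box at distance `suc b` in the next row
  -- would force one at distance `2 + b` in this row.
  at-row (suc i) = build-row b (tailClosed cl) (top ∘ Closed.diag cl (s≤s z≤n)) i 0<d

threshold : ∀ B {g} → Closed g → ¬ T (g 0 (suc B)) → ∃[ a ] a ≤ B × (∀ {d} → 0 < d → T (g 0 d) ⇔ d ≤ a)
threshold zero cl top = 0 , z≤n , λ 0<d →
  mk⇔ (λ h → ⊥-elim (top (Closed.first cl 0 0<d h))) (λ d≤0 → ⊥-elim (<-irrefl refl (≤-trans 0<d d≤0)))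
threshold (suc B) {g} cl top with T? (g 0 (suc B))
... | no  ¬h = let (a , a≤ , iff) = threshold B cl ¬h in a , m≤n⇒m≤1+n a≤ , iff
... | yes h  = suc B , ≤-refl , λ 0<d →
  mk⇔ (λ h′ → ≮⇒≥ λ B<d → top (Closed.reach cl (s≤s z≤n) B<d h′)) (λ d≤ → Closed.reach cl 0<d d≤ h)

χ-01 : ∀ m k → χ m k ≡ + 0 ⊎ (χ m k ≡ + 1 × m ≡ k)
χ-01 m k with m ≡ᵇ k in eq
... | true  = inj₂ (refl , ≡ᵇ⇒≡ m k (≡⇒T eq))
... | false = inj₁ refl

-- Both positive terms would have to sit at `k`, contrary to `i < c`.
at-weight≢2 : ∀ {n} (δ : Box n) {k} → k < n → ¬ at (weight δ) k ≡ + 2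
at-weight≢2 δ {k} k<n eq with trans (sym (at-weight δ k<n)) eq | χ-01 (Box.i δ) k | χ-01 (Box.c δ) k | χ-01 (Box.c′ δ) k
... | e | inj₁ p       | inj₁ q       | inj₁ r       rewrite p | q | r with e
...   | ()
at-weight≢2 δ k<n _ | e | inj₁ p | inj₁ q | inj₂ (r , _) rewrite p | q | r with e
... | ()
at-weight≢2 δ k<n _ | e | inj₁ p | inj₂ (q , _) | inj₁ r rewrite p | q | r with e
... | ()
at-weight≢2 δ k<n _ | e | inj₁ p | inj₂ (q , _) | inj₂ (r , _) rewrite p | q | r with e
... | ()
at-weight≢2 δ k<n _ | e | inj₂ (p , _) | inj₁ q | inj₁ r rewrite p | q | r with e
... | ()
at-weight≢2 δ k<n _ | e | inj₂ (p , _) | inj₁ q | inj₂ (r , _) rewrite p | q | r with e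
... | ()
at-weight≢2 δ k<n _ | _ | inj₂ (_ , i≡k) | inj₂ (_ , c≡k) | _ = <⇒≢ (Box.i<c δ) (trans i≡k (sym c≡k))

at-weight-positive : ∀ {n} (δ : Box n) {k m} → k < n → at (weight δ) k ≡ + (suc m) → Box.i δ ≡ k ⊎ Box.c δ ≡ k
at-weight-positive δ {k} k<n eq with trans (sym (at-weight δ k<n)) eq | χ-01 (Box.i δ) k | χ-01 (Box.c δ) k | χ-01 (Box.c′ δ) k
... | _ | inj₂ (_ , i≡k) | _              | _            = inj₁ i≡k
... | _ | inj₁ _         | inj₂ (_ , c≡k) | _            = inj₂ c≡k
... | e | inj₁ p         | inj₁ q         | inj₁ r       rewrite p | q | r with e
...   | ()
at-weight-positive δ k<n _ | e | inj₁ p | inj₁ q | inj₂ (r , _) rewrite p | q | r with e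
... | ()

psum-weight≢4 : ∀ {n} (δ : Box n) {k} → k < n → ¬ psum (weight δ) k ≡ + 4
psum-weight≢4 δ {k} k<n eq with trans (sym (psum-weight δ k<n)) eq
... | e with Box.i δ ≤ᵇ k | Box.c δ ≤ᵇ k | Box.c′ δ ≤ᵇ k | e
...   | true  | true  | true  | ()
...   | true  | true  | false | ()
...   | true  | false | true  | ()
...   | true  | false | false | ()
...   | false | true  | true  | ()
...   | false | true  | false | ()
...   | false | false | true  | ()
...   | false | false | false | ()

at-sum : ∀ {n} (β γ δ : Box n) → weight β ⊕ weight γ ≡ weight δ → ∀ k → at (weight β) k +ℤ at (weight γ) k ≡ at (weight δ) k
at-sum β γ δ eq k = trans (sym (at-⊕ (weight β) (weight γ) k)) (cong (λ w → at w k) eq)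

-- Two boxes of the first row add up to a vector with coefficient 2 at ε₀.
no-sum-top : ∀ {n} (β γ δ : Box n) → Box.i β ≡ 0 → Box.i γ ≡ 0 → ¬ weight β ⊕ weight γ ≡ weight δ
no-sum-top β γ δ refl refl eq = at-weight≢2 δ (Box.i<n β)
  (trans (sym (at-sum β γ δ eq 0)) (cong₂ _+ℤ_ (at-0 β refl) (at-0 γ refl)))
  where
  at-0 : ∀ (β : Box _) → Box.i β ≡ 0 → at (weight β) 0 ≡ + 1
  at-0 β i≡0 = trans (at-weight β (≤-trans (s≤s z≤n) (Box.i<n β)))
    (cong₂ _-ℤ_ (cong₂ _+ℤ_ (trans (cong (λ i → χ i 0) i≡0) refl)
                            (χ-diff {Box.c β} {0} (>⇒≢ (≤-<-trans z≤n (Box.i<c β)))))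
                (χ-diff {Box.c′ β} {0} (>⇒≢ (≤-<-trans z≤n (Box.i<c′ β)))))

-- The sum is positive at the three positions 0, i and c of the boxes (0, d) and (i, c).
no-sum-mixed : ∀ {n} (β γ δ : Box n) → Box.i β ≡ 0 → 0 < Box.i γ → Box.c γ < n → Box.c γ < Box.c′ β →
               ¬ (∀ k → at (weight β) k +ℤ at (weight γ) k ≡ at (weight δ) k)
no-sum-mixed {n} β@(box .0 d d′ 0<d 0<d′ _) γ@(box i c c′ i<c i<c′ c+c′) δ refl 0<i c<n c<d′ eq =
  -- The hypothesis `c < d′` keeps the negative term of the first root away from positions `i` and
  -- `c`, while `n < c′` makes the negative term of the second vanish.
  pigeon (support 0<n {0} at₀) (support (Box.i<n γ) atᵢ) (support c<n at-c)
  where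
  0<n : 0 < n
  0<n = Box.i<n β
  n<c′ : n < c′
  n<c′ = Box.inRange γ c<n

  support : ∀ {k} → k < n → ∀ {m} → at (weight β) k +ℤ at (weight γ) k ≡ + (suc m) → Box.i δ ≡ k ⊎ Box.c δ ≡ k
  support k<n h = at-weight-positive δ k<n (trans (sym (eq _)) h)

  -- The column `d` may coincide with `i` or `c`; the entry there is then 2 instead of 1, positive
  -- in either case.
  χ+1 : ∀ m k → ∃[ r ] χ m k +ℤ + 1 ≡ + (suc r)
  χ+1 m k with χ-01 m k
  ... | inj₁ z       = 0 , cong (_+ℤ + 1) z
  ... | inj₂ (o , _) = 1 , cong (_+ℤ + 1) o

  at₀ : at (weight β) 0 +ℤ at (weight γ) 0 ≡ + 1
  at₀ rewrite at-weight β 0<n | at-weight γ 0<n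
            | χ-diff {d} {0} (>⇒≢ 0<d) | χ-diff {d′} {0} (>⇒≢ 0<d′)
            | χ-diff {i} {0} (>⇒≢ 0<i) | χ-diff {c} {0} (>⇒≢ (<-trans 0<i i<c)) | χ-diff {c′} {0} (>⇒≢ (<-trans 0<i i<c′)) = refl

  atᵢ : at (weight β) i +ℤ at (weight γ) i ≡ + (suc (proj₁ (χ+1 d i)))
  atᵢ rewrite at-weight β (Box.i<n γ) | at-weight γ (Box.i<n γ)
            | χ-diff {0} {i} (<⇒≢ 0<i) | χ-diff {d′} {i} (>⇒≢ (<-trans i<c c<d′))
            | χ-same i | χ-diff {c} {i} (>⇒≢ i<c) | χ-diff {c′} {i} (>⇒≢ i<c′) =
    trans (simp (χ d i)) (proj₂ (χ+1 d i))
    where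
    simp : ∀ x → ((+ 0 +ℤ x) -ℤ + 0) +ℤ + 1 ≡ x +ℤ + 1
    simp = ℤ-Solver.solve-∀

  at-c : at (weight β) c +ℤ at (weight γ) c ≡ + (suc (proj₁ (χ+1 d c)))
  at-c rewrite at-weight β c<n | at-weight γ c<n
             | χ-diff {0} {c} (<⇒≢ (<-trans 0<i i<c)) | χ-diff {d′} {c} (>⇒≢ c<d′)
             | χ-same c | χ-diff {i} {c} (<⇒≢ i<c) | χ-diff {c′} {c} (>⇒≢ (<-trans c<n n<c′)) =
    trans (simp (χ d c)) (proj₂ (χ+1 d c))
    where
    simp : ∀ x → ((+ 0 +ℤ x) -ℤ + 0) +ℤ + 1 ≡ x +ℤ + 1
    simp = ℤ-Solver.solve-∀

  pigeon : Box.i δ ≡ 0 ⊎ Box.c δ ≡ 0 → Box.i δ ≡ i ⊎ Box.c δ ≡ i → Box.i δ ≡ c ⊎ Box.c δ ≡ c → ⊥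
  pigeon (inj₂ x) _ _ = <⇒≢ (≤-<-trans z≤n (Box.i<c δ)) (sym x)
  pigeon (inj₁ x) (inj₁ y) _ = <⇒≢ 0<i (trans (sym x) y)
  pigeon (inj₁ x) (inj₂ y) (inj₁ z) = <⇒≢ (<-trans 0<i i<c) (trans (sym x) z)
  pigeon (inj₁ x) (inj₂ y) (inj₂ z) = <⇒≢ i<c (trans (sym y) z)

-- Columns below `n` give roots of the form εᵢ + ε_c. The last prefix sum is the sum of all
-- coordinates, 2 for each of them, and a positive root cannot reach 4.
no-sum-lower : ∀ {n} (β γ δ : Box n) → Box.c β < n → Box.c γ < n → ¬ weight β ⊕ weight γ ≡ weight δ
no-sum-lower {suc n} β γ δ c<n c<n′ eq = psum-weight≢4 δ {n} ≤-refl
  (trans (cong (λ w → psum w n) (sym eq)) (trans (psum-⊕ (weight β) (weight γ) n) (cong₂ _+ℤ_ (psum-2 β c<n) (psum-2 γ c<n′))))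
  where
  psum-2 : ∀ (β : Box (suc n)) → Box.c β < suc n → psum (weight β) n ≡ + 2
  psum-2 β c<n = trans (psum-weight β {n} ≤-refl) (cong₂ _-ℤ_
    (cong₂ _+ℤ_ (step-1 (m<1+n⇒m≤n (Box.i<n β))) (step-1 (m<1+n⇒m≤n c<n)))
    (step-0 (<-trans (n<1+n n) (Box.inRange β c<n))))

-- The terms in `c` and `c′` cancel and leave ε₀ + ε₁, the root of the box `(0, 1)`.
root-sum : ∀ {n} (β γ : Box n) → Box.i β ≡ 0 → Box.i γ ≡ 1 → Box.c β ≡ Box.c′ γ → Box.c′ β ≡ Box.c γ →
           (weight β ⊕ weight γ) ∈ posRootsL n
root-sum {n} β@(box .0 c c′ 0<c 0<c′ c+c′) γ@(box .1 .c′ .c 1<c′ 1<c eq) refl refl refl refl =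
  from ∈-posRoots (top , ≡weight top λ {k} k<n →
    trans (at-⊕ (weight β) (weight γ) k) (trans (cong₂ _+ℤ_ (at-weight β k<n) (at-weight γ k<n))
      (trans (cancel (χ 0 k) (χ 1 k) (χ c k) (χ c′ k))
        (sym (trans (cong (λ z → (χ 0 k +ℤ χ 1 k) -ℤ z) (χ-outside {n} {n + n ∸ 1} k<n n≤2n-1)) (ℤ.+-identityʳ _))))))
  where
  1<n : 1 < n
  1<n = Box.i<n γ
  n≤2n-1 : n ≤ n + n ∸ 1
  n≤2n-1 = n≤n+n∸ (<⇒≤ 1<n)
  top : Box n
  top = box 0 1 (n + n ∸ 1) (s≤s z≤n) (≤-trans (≤-trans (s≤s z≤n) 1<n) n≤2n-1)
            (m+[n∸m]≡n (≤-trans (<⇒≤ 1<n) (m≤m+n n n)))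
  cancel : ∀ p q x y → ((p +ℤ x) -ℤ y) +ℤ ((q +ℤ y) -ℤ x) ≡ p +ℤ q
  cancel = ℤ-Solver.solve-∀

T-isUpper : ∀ {n} {I : Sub n} → T (isUpper n I) ⇔
            (∀ t → T (lookup I t) → ∀ s → T (covers (root n s) (root n t)) → T (lookup I s))
T-isUpper {n} {I} = mk⇔
  (λ h t t∈ s → to (T-⇒ {covers (root n s) (root n t)})
    (to (T-allFin (λ s → not (covers (root n s) (root n t)) ∨ lookup I s)) (to (T-⇒ {lookup I t}) (to (T-allFin outer) h t) t∈) s))
  (λ f → from (T-allFin outer) λ t → from (T-⇒ {lookup I t}) λ t∈ →
    from (T-allFin (λ s → not (covers (root n s) (root n t)) ∨ lookup I s)) λ s →
      from (T-⇒ {covers (root n s) (root n t)}) (f t t∈ s))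
  where
  outer : Fin (N n) → Bool
  outer t = not (lookup I t) ∨ all (λ s → not (covers (root n s) (root n t)) ∨ lookup I s) (idx n)

T-isAbelian : ∀ {n} {I : Sub n} → T (isAbelian n I) ⇔
              (∀ s → T (lookup I s) → ∀ t → T (lookup I t) → ¬ (root n s ⊕ root n t) ∈ posRootsL n)
T-isAbelian {n} {I} = mk⇔
  (λ h s s∈ t t∈ r → to T-not (to (T-⇒ {lookup I t}) (to (T-allFin (inner s)) (to (T-⇒ {lookup I s}) (to (T-allFin outer) h s) s∈) t) t∈)
                       (from (T-∈ᵇ (posRootsL n)) r))
  (λ f → from (T-allFin outer) λ s → from (T-⇒ {lookup I s}) λ s∈ →
    from (T-allFin (inner s)) λ t → from (T-⇒ {lookup I t}) λ t∈ →
      from T-not (f s s∈ t t∈ ∘ to (T-∈ᵇ (posRootsL n))))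
  where
  inner : Fin (N n) → Fin (N n) → Bool
  inner s t = not (lookup I t) ∨ not ((root n s ⊕ root n t) ∈ᵇ posRootsL n)
  outer : Fin (N n) → Bool
  outer s = not (lookup I s) ∨ all (inner s) (idx n)

valid-zero : ∀ {b a} → a ≤ 3 + (b + b) → Valid b a 0
valid-zero {b} {zero}  _  = inj₂ (refl , inj₁ refl)
valid-zero {b} {suc a} a≤ with m≤n⇒m<n∨m≡n a≤
... | inj₁ a<  = inj₁ (s≤s z≤n , subst (_≤ 2 + (b + b)) (sym (+-identityʳ (suc a))) (m<1+n⇒m≤n a<))
... | inj₂ a≡  = inj₂ (refl , inj₂ a≡)

-- The correspondence between valid codes and abelian ideals

module AbelianIdeals (n b : ℕ) (n≡2+b : n ≡ 2 + b) where
  open Encoding n b n≡2+b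

  enc-upper : ∀ (x : Code b) → Ok x → T (isUpper n (enc x))
  enc-upper x ok = from (T-isUpper {n} {enc x}) λ t t∈ s cov →
    let (i≤ , c≤) = covers⇒≥ (boxAt {n} s) (boxAt {n} t) (subst₂ (λ u v → T (covers {n} u v)) (root≡weight {n} s) (root≡weight {n} t) cov)
    in from (T-enc x s) (≤-trans c≤ (rowCode-columns x ok (iₜ s) (Box.i<c (boxAt {n} t)) (to (T-enc x t) t∈) i≤))

  lower-column : ∀ (x : Code b) → Ok x → ∀ {i c} → 0 < i → i < c → c ≤ i + rowCode x i →
                 c ≤ suc (row (proj₂ x) 0) × 0 < row (proj₂ x) 0
  lower-column x ok 0<i i<c c≤ = c≤1+m , m>0
    where
    c≤1+m : _ ≤ suc (row (proj₂ x) 0)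
    c≤1+m = rowCode-columns x ok 1 i<c c≤ 0<i
    m>0 : 0 < row (proj₂ x) 0
    m>0 = ≤-trans 0<i (m<1+n⇒m≤n (≤-trans i<c c≤1+m))

  lower-column<n : ∀ (x : Code b) → Ok x → ∀ {i c} → 0 < i → i < c → c ≤ i + rowCode x i → c < n
  lower-column<n x ok 0<i i<c c≤ = subst (_ <_) (sym n≡2+b)
    (s≤s (≤-trans (proj₁ (lower-column x ok 0<i i<c c≤)) (s≤s (row≤ (proj₂ x) 0))))

  -- The bound on the two longest rows enters here: `c ≤ a` and `d ≤ m + 1` give
  -- `c + d ≤ 2n − 1 < c + c′`.
  complement-bound : ∀ (x : Code b) → Ok x → ∀ {c c′ i d} → c + c′ ≡ n + n → c ≤ rowCode x 0 →
                     0 < i → i < d → d ≤ i + rowCode x i → d < c′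
  complement-bound (a , v) ok {c} {c′} {i} {d} eq c≤a 0<i i<d d≤ with lower-column (a , v) ok 0<i i<d d≤
  ... | d≤1+m , 0<m = +-cancelˡ-< c d c′ (subst (c + d <_) (sym eq)
    (≤-<-trans (+-mono-≤ c≤a d≤1+m) (bound ok)))
    where
    bound : Valid b a (row v 0) → a + suc (row v 0) < n + n
    bound (inj₁ (_ , le)) = subst₂ _<_ (sym (+-suc a (row v 0))) (sym (trans (cong (λ n → n + n) n≡2+b) (4+ b)))
      (s≤s (s≤s (≤-trans le ≤-refl)))
      where
      4+ : ∀ b → (2 + b) + (2 + b) ≡ 4 + (b + b)
      4+ = solve-∀
    bound (inj₂ (m≡0 , _)) = ⊥-elim (<⇒≢ 0<m (sym m≡0))

  enc-abelian : ∀ (x : Code b) → Ok x → T (isAbelian n (enc x))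
  enc-abelian x ok = from (T-isAbelian {n} {enc x}) λ s s∈ t t∈ r →
    let (δ , eq) = to ∈-posRoots r in
    no-sum (boxAt {n} s) (boxAt {n} t) δ (to (T-enc x s) s∈) (to (T-enc x t) t∈)
      (trans (sym (cong₂ _⊕_ (root≡weight {n} s) (root≡weight {n} t))) eq)
    where
    no-sum : ∀ β γ δ → Box.c β ≤ Box.i β + rowCode x (Box.i β) → Box.c γ ≤ Box.i γ + rowCode x (Box.i γ) →
             ¬ weight {n} β ⊕ weight γ ≡ weight δ
    no-sum β γ δ β∈ γ∈ eq = cases (Box.i β) (Box.i γ) refl refl
      where
      in-row : ∀ β {i} → Box.i β ≡ i → Box.c β ≤ Box.i β + rowCode x (Box.i β) → Box.c β ≤ i + rowCode x i
      in-row β refl h = h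
      pos : ∀ (β : Box n) {i} → Box.i β ≡ suc i → 0 < Box.i β
      pos β e = subst (0 <_) (sym e) (s≤s z≤n)
      cases : ∀ i j → Box.i β ≡ i → Box.i γ ≡ j → ⊥
      cases zero zero iβ iγ = no-sum-top β γ δ iβ iγ eq
      cases zero (suc j) iβ iγ = no-sum-mixed β γ δ iβ (pos γ iγ)
        (lower-column<n x ok (pos γ iγ) (Box.i<c γ) γ∈)
        (complement-bound x ok (Box.c+c′ β) (in-row β iβ β∈) (pos γ iγ) (Box.i<c γ) γ∈)
        (at-sum β γ δ eq)
      cases (suc i) zero iβ iγ = no-sum-mixed γ β δ iγ (pos β iβ)
        (lower-column<n x ok (pos β iβ) (Box.i<c β) β∈)
        (complement-bound x ok (Box.c+c′ γ) (in-row γ iγ γ∈) (pos β iβ) (Box.i<c β) β∈)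
        (λ k → trans (ℤ.+-comm (at (weight γ) k) _) (at-sum β γ δ eq k))
      cases (suc i) (suc j) iβ iγ = no-sum-lower β γ δ
        (lower-column<n x ok (pos β iβ) (Box.i<c β) β∈) (lower-column<n x ok (pos γ iγ) (Box.i<c γ) γ∈) eq

  module Decode (I : Sub n) (upper : T (isUpper n I)) (abelian : T (isAbelian n I)) where

    isCell : ℕ → ℕ → Fin (N n) → Bool
    isCell i c t = lookup I t ∧ ((i ≡ᵇ iₜ t) ∧ (c ≡ᵇ cₜ t))

    opaque
      -- Defined for all pairs and false outside the diagram, so that closure can be stated without
      -- side conditions on the indices.
      cell : ℕ → ℕ → Bool
      cell i c = any (isCell i c) (allFin (N n))

      T-cell : ∀ {i c} → T (cell i c) ⇔ (∃[ t ] T (lookup I t) × i ≡ iₜ t × c ≡ cₜ t)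
      T-cell {i} {c} = mk⇔
        (λ h → let (t , _ , h₁) = to (T-any (isCell i c) (allFin (N n))) h
                   (t∈ , h₂) = to (T-∧ {lookup I t}) h₁
                   (i≡ , c≡) = to (T-∧ {i ≡ᵇ iₜ t}) h₂
               in t , t∈ , ≡ᵇ⇒≡ i (iₜ t) i≡ , ≡ᵇ⇒≡ c (cₜ t) c≡)
        (λ (t , t∈ , i≡ , c≡) → from (T-any (isCell i c) (allFin (N n)))
          (t , ∈-allFin t , from (T-∧ {lookup I t}) (t∈ , from (T-∧ {i ≡ᵇ iₜ t}) (≡⇒≡ᵇ i (iₜ t) i≡ , ≡⇒≡ᵇ c (cₜ t) c≡))))

    T-cell-at : ∀ t → T (lookup I t) ⇔ T (cell (iₜ t) (cₜ t))
    T-cell-at t = mk⇔ (λ t∈ → from T-cell (t , t∈ , refl , refl))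
      (λ h → let (s , s∈ , i≡ , c≡) = to T-cell h in
        subst (T ∘ lookup I) (trans (sym (indexOf-unique {n} (boxAt {n} t) i≡ c≡)) (indexOf-unique {n} (boxAt {n} t) refl refl)) s∈)

    cell-box : ∀ β → T (cell (Box.i β) (Box.c β)) → T (lookup I (indexOf β))
    cell-box β h = let (t , t∈ , i≡ , c≡) = to T-cell h in subst (T ∘ lookup I) (sym (indexOf-unique β i≡ c≡)) t∈

    cell-bounds : ∀ {i c} → T (cell i c) → ∃[ β ] Box.i {n} β ≡ i × Box.c β ≡ c
    cell-bounds h = let (t , _ , i≡ , c≡) = to T-cell h in boxAt {n} t , sym i≡ , sym c≡

    cell-up : ∀ (γ μ : Box n) → T (covers (weight γ) (weight μ)) →
              T (cell (Box.i μ) (Box.c μ)) → T (cell (Box.i γ) (Box.c γ))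
    cell-up γ μ cov h = from T-cell (indexOf γ ,
      to (T-isUpper {n} {I}) upper (indexOf μ) (cell-box μ h) (indexOf γ)
        (subst₂ (λ u v → T (covers {n} u v)) (sym (root-indexOf {n} γ)) (sym (root-indexOf {n} μ)) cov) ,
      sym (proj₁ (boxAt-indexOf {n} γ)) , sym (proj₂ (boxAt-indexOf {n} γ)))

    cell-left : ∀ {i c} → i < c → T (cell i (suc c)) → T (cell i c)
    cell-left {i} {c} i<c h with cell-bounds h
    ... | μ@(box .i .(suc c) c′ _ i<c′ eq) , refl , refl =
      cell-up (box i c (suc c′) i<c (m≤n⇒m≤1+n i<c′) (trans (+-suc c c′) eq)) μ (covers-left _ μ refl refl) h

    cell-above : ∀ {i c} → T (cell (suc i) c) → T (cell i c)
    cell-above {i} {c} h with cell-bounds h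
    ... | μ@(box .(suc i) .c c′ i<c i<c′ eq) , refl , refl =
      cell-up (box i c c′ (<-trans (n<1+n i) i<c) (<-trans (n<1+n i) i<c′) eq) μ (covers-above _ μ refl refl) h

    -- This is all that decoding takes from abelianness: the two roots would add up to ε₀ + ε₁.
    no-cells : ∀ {c c′} → c + c′ ≡ n + n → T (cell 0 c) → ¬ T (cell 1 c′)
    no-cells {c} {c′} eq h₀ h₁ with cell-bounds h₀ | cell-bounds h₁
    ... | β@(box .0 .c d′ _ _ eqβ) , refl , refl | γ@(box .1 .c′ d _ _ eqγ) , refl , refl =
      to (T-isAbelian {n} {I}) abelian (indexOf β) (cell-box β h₀) (indexOf γ) (cell-box γ h₁)
        (subst (_∈ posRootsL n) (sym (cong₂ _⊕_ (root-indexOf {n} β) (root-indexOf {n} γ)))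
          (root-sum β γ refl refl (+-cancelˡ-≡ c′ c d (trans (+-comm c′ c) (trans eq (sym eqγ))))
                                  (+-cancelˡ-≡ c d′ c′ (trans eqβ (sym eq)))))

    diagonal : ℕ → ℕ → Bool
    diagonal i d = cell i (i + d)

    closed : Closed diagonal
    closed = record
      { left = λ {i} {d} 0<d h → cell-left (m<m+n i 0<d) (subst (T ∘ cell i) (+-suc i d) h)
      ; diag = λ {i} {d} _ h → subst (T ∘ cell i) (sym (+-suc i d)) (cell-above h) }

    2n≡ : n + n ≡ 4 + (b + b)
    2n≡ = trans (cong (λ n → n + n) n≡2+b) (4+ b)
      where
      4+ : ∀ b → (2 + b) + (2 + b) ≡ 4 + (b + b)
      4+ = solve-∀

    -- The box would lie in column `2n`, which forces `c′ = 0`, against `0 < c′`.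
    top-empty : ¬ T (diagonal 0 (4 + (b + b)))
    top-empty h with cell-bounds h
    ... | box _ _ c′ _ 0<c′ eq , refl , refl = <⇒≢ 0<c′ (sym (+-cancelˡ-≡ (4 + (b + b)) c′ 0
      (trans eq (trans 2n≡ (sym (+-identityʳ _))))))

    -- The box `(1, n)` would bring along `(0, n)`, and column `n` is its own complement. Hence the
    -- rows below the first fit into `b` bits.
    second-empty : ¬ T (diagonal 1 (suc b))
    second-empty h = no-cells (cong₂ _+_ (sym n≡2+b) (sym n≡2+b)) (cell-above h) h

    first-row = threshold (3 + (b + b)) closed top-empty

    a : ℕ
    a = proj₁ first-row

    v : Vec Bool b
    v = build b (diagonal ∘ suc)

    T-row-0 : ∀ {d} → 0 < d → T (diagonal 0 d) ⇔ d ≤ a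
    T-row-0 = proj₂ (proj₂ first-row)

    T-row-suc : ∀ i {d} → 0 < d → T (diagonal (suc i) d) ⇔ d ≤ row v i
    T-row-suc = build-row b (tailClosed closed) second-empty

    valid-suc : ∀ m → row v 0 ≡ suc m → Valid b a (suc m)
    valid-suc m eq = inj₁ (m<a , ≮⇒≥ λ big → no-cells comp (from (T-row-0 c>0) (c≤a big)) box₁)
      where
      box₁ : T (diagonal 1 (suc m))
      box₁ = from (T-row-suc 0 (s≤s z≤n)) (≤-reflexive (sym eq))
      m<a : suc m < a
      m<a = to (T-row-0 (s≤s z≤n)) (cell-above box₁)
      m<b : m < b
      m<b = subst (_≤ b) eq (row≤ v 0)
      c : ℕ
      -- The complement of column `1 + suc m`, where the second row ends. If `a + suc m` exceeded
      -- the bound, the first row would reach column `c` and a forbidden pair would appear.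
      c = 2 + (b + b) ∸ m
      m<2+2b : m < 2 + (b + b)
      m<2+2b = ≤-trans m<b (≤-trans (m≤m+n b b) (m≤n+m (b + b) 2))
      c>0 : 0 < c
      c>0 = m<n⇒0<n∸m m<2+2b
      comp : c + (1 + suc m) ≡ n + n
      comp = trans (+-suc c (suc m)) (trans (cong suc (+-suc c m))
        (trans (cong (suc ∘ suc) (m∸n+n≡m (<⇒≤ m<2+2b))) (sym 2n≡)))
      c≤a : 2 + (b + b) < a + suc m → c ≤ a
      c≤a big = m≤n+o⇒m∸n≤o (2 + (b + b)) m
        (subst (2 + (b + b) ≤_) (+-comm a m) (m<1+n⇒m≤n (subst (2 + (b + b) <_) (+-suc a m) big)))

    valid : Ok (a , v)
    valid = by-cases (row v 0) refl
      where
      by-cases : ∀ m → row v 0 ≡ m → Valid b a (row v 0)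
      by-cases zero    eq = subst (Valid b a) (sym eq) (valid-zero {b} (proj₁ (proj₂ first-row)))
      by-cases (suc m) eq = subst (Valid b a) (sym eq) (valid-suc m eq)

    T-cell-row : ∀ i {d} → 0 < d → T (diagonal i d) ⇔ d ≤ rowCode (a , v) i
    T-cell-row zero    = T-row-0
    T-cell-row (suc i) = T-row-suc i

    I≡enc : I ≡ enc (a , v)
    I≡enc = lookup-ext λ t →
      let i = iₜ t ; c = cₜ t
          c≡ = m+[n∸m]≡n (<⇒≤ (Box.i<c (boxAt {n} t)))
          iff = T-cell-row i {c ∸ i} (m<n⇒0<n∸m (Box.i<c (boxAt {n} t)))
      in mk⇔
        (λ t∈ → from (T-enc (a , v) t) (subst (_≤ i + rowCode (a , v) i) c≡
          (+-monoʳ-≤ i (to iff (subst (T ∘ cell i) (sym c≡) (to (T-cell-at t) t∈))))))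
        (λ t∈ → from (T-cell-at t) (subst (T ∘ cell i) c≡ (from iff
          (+-cancelˡ-≤ i _ _ (subst (_≤ i + rowCode (a , v) i) (sym c≡) (to (T-enc (a , v) t) t∈))))))

  ∈-Ab : ∀ {I} → I ∈ Ab n ⇔ (∃[ x ] Ok x × I ≡ enc x)
  ∈-Ab {I} = mk⇔
    (λ h → let (u , ab) = to (T-∧ {isUpper n I}) (proj₂ (to (∈-filterᵇ isIdeal (allSubsets (N n))) h)) in
      _ , Decode.valid I u ab , Decode.I≡enc I u ab)
    (λ { (x , ok , refl) → from (∈-filterᵇ isIdeal (allSubsets (N n)))
      (∈-allSubsets (enc x) , from (T-∧ {isUpper n (enc x)}) (enc-upper x ok , enc-abelian x ok)) })

    where
    isIdeal : Sub n → Bool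
    isIdeal I = isUpper n I ∧ isAbelian n I

  open Poset ∈-Ab public using (Ku-closed; Kl-closed)

-- The three formulas

binom-C⁻ : ∀ n k → binom n (+ (2 * k) -ℤ + 1) ≡ C⁻ n (dbl k)
binom-C⁻ n k rewrite sym (dbl≡2* k) = go k
  where
  go : ∀ k → binom n (+ dbl k -ℤ + 1) ≡ C⁻ n (dbl k)
  go zero    = refl
  go (suc k) = refl

binom-pred-C⁻ : ∀ n k → binom n (+ (2 * k) -ℤ + 2) ≡ C⁻ n (pred (dbl k))
binom-pred-C⁻ n k rewrite sym (dbl≡2* k) = go k
  where
  go : ∀ k → binom n (+ dbl k -ℤ + 2) ≡ C⁻ n (pred (dbl k))
  go zero    = refl
  go (suc k) = refl

2*+1 : ∀ k → 2 * k + 1 ≡ suc (dbl k)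
2*+1 k = trans (+-comm (2 * k) 1) (cong suc (sym (dbl≡2* k)))

coeffSqMul-cong : ∀ {d d′} → (∀ j → d j ≡ d′ j) → ∀ k → coeffSqMul d k ≡ coeffSqMul d′ k
coeffSqMul-cong h zero          = h 0
coeffSqMul-cong h (suc zero)    = cong₂ (λ x y → x -ℤ + 2 ℤ.* y) (h 1) (h 0)
coeffSqMul-cong h (suc (suc k)) =
  cong₂ _+ℤ_ (cong₂ (λ x y → x -ℤ + 2 ℤ.* y) (h (suc (suc k))) (h (suc k))) (h k)

-- Pascal's rule takes all binomials down to row `b = n − 2`. There the terms with even lower index
-- cancel, and those with odd index form the second difference that multiplication by `(q − 1)²`
-- produces.
difference : ∀ b k → + ((3 + b) C dbl k) -ℤ + ιclosed b k ≡ coeffSqMul (λ j → -ℤ (+ (b C suc (dbl j)))) k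
difference b zero rewrite pascal b 1 = lemma (+ (b C 1))
  where
  lemma : ∀ x → + 1 -ℤ (((x +ℤ + 1) +ℤ + 0) +ℤ + 0) ≡ -ℤ x
  lemma = ℤ-Solver.solve-∀
difference b (suc k) = trans (general (dbl k)) (rest k)
  where
  -- With `m = 2k`, the last term `C⁻ b m` belongs to the coefficient two places down. It is 0 for
  -- `m = 0`, so the coefficient of `q` is handled together with the higher ones.
  general : ∀ m → + ((3 + b) C suc (suc m)) -ℤ + (suc b C (3 + m) + C⁻ (2 + b) (2 + m) + C⁻ (suc b) (suc m)) ≡
            ((-ℤ (+ (b C (3 + m)))) -ℤ + 2 ℤ.* (-ℤ (+ (b C (1 + m))))) +ℤ (-ℤ (+ (C⁻ b m)))
  general m rewrite pascal (2 + b) (2 + m) | pascal (1 + b) (2 + m) | pascal (1 + b) (1 + m)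
                  | pascal b (3 + m) | pascal b (2 + m) | pascal b (1 + m) | pascal b m =
    lemma (+ (b C (3 + m))) (+ (b C (2 + m))) (+ (b C (1 + m))) (+ (b C m)) (+ (C⁻ b m))
    where
    lemma : ∀ p q r s t →
            (((q +ℤ r) +ℤ (r +ℤ s)) +ℤ ((r +ℤ s) +ℤ (s +ℤ t))) -ℤ (((p +ℤ q) +ℤ ((r +ℤ s) +ℤ (s +ℤ t))) +ℤ (s +ℤ t))
            ≡ ((-ℤ p) -ℤ + 2 ℤ.* (-ℤ r)) +ℤ (-ℤ t)
    lemma = ℤ-Solver.solve-∀

  rest : ∀ k → ((-ℤ (+ (b C (3 + dbl k)))) -ℤ + 2 ℤ.* (-ℤ (+ (b C (1 + dbl k))))) +ℤ (-ℤ (+ (C⁻ b (dbl k))))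
               ≡ coeffSqMul (λ j → -ℤ (+ (b C suc (dbl j)))) (suc k)
  rest zero    = ℤ.+-identityʳ _
  rest (suc k) = refl

theorem5p3 : (n : ℕ) → 2 ≤ n →
    ((k : ℕ) → Ku n k ≡ (n + 1) C (2 * k))
    × ((k : ℕ) → Kl n k ≡ (n ∸ 1) C (2 * k + 1) + binom n (+ (2 * k) -ℤ + 1) + binom (n ∸ 1) (+ (2 * k) -ℤ + 2))
    × ((k : ℕ) → + Ku n k -ℤ + Kl n k ≡ coeffSqMul (λ j → -ℤ (+ ((n ∸ 2) C (2 * j + 1)))) k)
theorem5p3 n 2≤n = upper , lower-side , deviation
  where
  b : ℕ
  b = n ∸ 2

  n≡2+b : n ≡ 2 + b
  n≡2+b = sym (m+[n∸m]≡n 2≤n)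

  open AbelianIdeals n b n≡2+b using (Ku-closed; Kl-closed)

  upper : ∀ k → Ku n k ≡ (n + 1) C (2 * k)
  upper k = trans (Ku-closed k) (cong₂ _C_ (trans (cong suc (sym n≡2+b)) (+-comm 1 n)) (dbl≡2* k))

  rhs : ℕ → ℕ → ℕ
  rhs n k = (n ∸ 1) C (2 * k + 1) + binom n (+ (2 * k) -ℤ + 1) + binom (n ∸ 1) (+ (2 * k) -ℤ + 2)

  ιclosed≡rhs : ∀ k → ιclosed b k ≡ rhs (2 + b) k
  ιclosed≡rhs k = sym (cong₂ _+_ (cong₂ _+_ (cong (suc b C_) (2*+1 k)) (binom-C⁻ (2 + b) k)) (binom-pred-C⁻ (suc b) k))

  lower-side : ∀ k → Kl n k ≡ rhs n k
  lower-side k = trans (Kl-closed k) (trans (ιclosed≡rhs k) (cong (λ n → rhs n k) (sym n≡2+b)))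

  deviation : ∀ k → + Ku n k -ℤ + Kl n k ≡ coeffSqMul (λ j → -ℤ (+ (b C (2 * j + 1)))) k
  deviation k = trans (cong₂ (λ x y → + x -ℤ + y) (Ku-closed k) (Kl-closed k))
    (trans (difference b k) (coeffSqMul-cong (λ j → cong (λ m → -ℤ (+ (b C m))) (sym (2*+1 j))) k))
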